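{- Let $\omega:\Pi(\mathbf{x})\to\Pi(\mathbf{x})$ be the linear map with $\omega(e_\pi)=h_\pi$ for all set partitions $\pi$. Then: (i) $\omega$ is an involution; (ii) each $p_\pi$ is an eigenvector of $\omega$ with eigenvalue $(-1)^\pi$; (iii) $\omega\rho=\rho\omega$, where on the left $\omega$ denotes the usual involution of the ordinary symmetric functions $\Lambda(\mathbf x)$ (the linear map with $\omega(e_\lambda)=h_\lambda$) and $\rho$ is the projection letting the variables commute.
   Context: $\Pi(\mathbf{x})$ is the algebra of elements of bounded degree in $\mathbb{Q}\langle\langle x_1,x_2,\ldots\rangle\rangle$ (formal power series in noncommuting variables) invariant under all permutations of the variables; $\rho:\mathbb{Q}\langle\langle x_1,x_2,\ldots\rangle\rangle\to\mathbb{Q}[[x_1,x_2,\ldots]]$ lets the variables commute. For a set partition $\pi$ of $[n]$, with sums over $n$-tuples $(i_1,\dots,i_n)$ of positive integers: $p_\pi=\sum x_{i_1}\cdots x_{i_n}$ over tuples with $i_j=i_k$ whenever $j,k$ lie in the same block of $\pi$; $e_\pi=\sum x_{i_1}\cdots x_{i_n}$ over tuples with $i_j\neq i_k$ whenever $j\ne k$ lie in the same block. For $f:[n]\to\{x_1,x_2,\ldots\}$ let $\ker f$ be the set partition whose blocks are the nonempty fibers of $f$, and $M_f=f(1)\cdots f(n)$. Then $h_\pi=\sum_{(f,L)}M_f$ over all pairs with $f:[n]\to\{x_1,x_2,\dots\}$ and $L$ a choice of linear ordering of the elements of each block of $(\ker f)\wedge\pi$ (meet in the refinement order). The $e_\pi$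 (over all $n\ge0$ and $\pi$) form a basis of $\Pi(\mathbf x)$. The sign $(-1)^\pi$ is the sign of any permutation whose cycles are the blocks of $\pi$. -}

module Defs where

open import Data.Bool using (Bool; true; false; _∧_; _∨_; not; if_then_else_)
open import Data.Nat as ℕ using (ℕ; zero; suc; _≡ᵇ_; _∸_; _!; _<_; _≥_)
open import Data.Product using (_×_; _,_; Σ; ∃)
open import Data.List using (List; []; _∷_; length; map; foldr; zip; filter; concatMap; replicate; upTo; _++_; deduplicateᵇ)
open import Data.List.Relation.Unary.All using (All)
open import Data.List.Relation.Unary.Linked using (Linked)
open import Data.List.Relation.Binary.Permutation.Propositional using (_↭_)
open import Data.Rational as ℚ using (ℚ; 0ℚ; 1ℚ; _+_; _*_; -_)
open import Data.Integer using (+_)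
open import Function.Bundles using (_↔_; Inverse)
open import Relation.Binary.PropositionalEquality using (_≡_)
open import Data.Bool.Properties using (T?)
open import Data.Bool using (T)

-- Variables x₁,x₂,… are indexed by ℕ.  A monomial in noncommuting
-- variables is a word (List ℕ); a formal power series in noncommuting
-- variables over ℚ is its coefficient function.
Series : Set
Series = List ℕ → ℚ

_≈_ : Series → Series → Set
F ≈ G = ∀ w → F w ≡ G w
infix 4 _≈_

_⊕_ : Series → Series → Series
(F ⊕ G) w = F w + G w
infixl 6 _⊕_

_•_ : ℚ → Series → Series
(a • F) w = a * F w
infixr 7 _•_

BoundedDegree : Series → Set
BoundedDegree F = ∃ λ d → ∀ w → d < length w → F w ≡ 0ℚ

VarSymmetric : Series → Set
VarSymmetric F = ∀ (σ : ℕ ↔ ℕ) w → F (map (Inverse.to σ) w) ≡ F w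

InΠ : Series → Set
InΠ F = BoundedDegree F × VarSymmetric F

-- Commuting variables: a series in Q[[x₁,x₂,…]] is represented by a
-- coefficient function on words which is invariant under rearranging
-- the letters (the coefficient of a commutative monomial is the value
-- at any word representing it).
Commutative : Series → Set
Commutative F = ∀ u w → u ↭ w → F u ≡ F w

InΛ : Series → Set
InΛ F = Commutative F × BoundedDegree F × VarSymmetric F

allᵇ : {A : Set} → (A → Bool) → List A → Bool
allᵇ P [] = true
allᵇ P (x ∷ xs) = P x ∧ allᵇ P xs

sumℚ : List ℚ → ℚ
sumℚ = foldr _+_ 0ℚ

prodℚ : List ℚ → ℚ
prodℚ = foldr _*_ 1ℚ

ℕ→ℚ : ℕ → ℚ
ℕ→ℚ n = (+ n) ℚ./ 1

boolℚ : Bool → ℚ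
boolℚ b = if b then 1ℚ else 0ℚ

countᵇ : ℕ → List ℕ → ℕ
countᵇ x [] = 0
countᵇ x (y ∷ ys) = if x ≡ᵇ y then suc (countᵇ x ys) else countᵇ x ys

eqPair : ℕ × ℕ → ℕ × ℕ → Bool
eqPair (a , b) (c , d) = (a ≡ᵇ c) ∧ (b ≡ᵇ d)

countPair : ℕ × ℕ → List (ℕ × ℕ) → ℕ
countPair p [] = 0
countPair p (q ∷ qs) = if eqPair p q then suc (countPair p qs) else countPair p qs

distinct : List ℕ → List ℕ
distinct = deduplicateᵇ _≡ᵇ_

-- Set partitions of [n].  A set partition π of [n] is given by a list
-- of block labels of length n: positions j,k (1-based, in order) lie in
-- the same block iff they carry the same label.  Every set partition
-- arises this way.
SetPartition : Set
SetPartition = List ℕ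

#blocks : SetPartition → ℕ
#blocks π = length (distinct π)

-- (-1)^π = (-1)^(n - #blocks), the sign of a permutation whose cycles
-- are the blocks of π
signℚ : ℕ → ℚ
signℚ zero = 1ℚ
signℚ (suc k) = - signℚ k

sgn : SetPartition → ℚ
sgn π = signℚ (length π ∸ #blocks π)

pairwise : (ℕ × ℕ → ℕ × ℕ → Bool) → List (ℕ × ℕ) → Bool
pairwise R [] = true
pairwise R (z ∷ zs) = allᵇ (R z) zs ∧ pairwise R zs

pCoeffOK : ℕ × ℕ → ℕ × ℕ → Bool
pCoeffOK (b , x) (b' , x') = not (b ≡ᵇ b') ∨ (x ≡ᵇ x')

p : SetPartition → Series
p π w = boolℚ ((length w ≡ᵇ length π) ∧ pairwise pCoeffOK (zip π w))

eCoeffOK : ℕ × ℕ → ℕ × ℕ → Bool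
eCoeffOK (b , x) (b' , x') = not ((b ≡ᵇ b') ∧ (x ≡ᵇ x'))

e : SetPartition → Series
e π w = boolℚ ((length w ≡ᵇ length π) ∧ pairwise eCoeffOK (zip π w))

-- h_π : the coefficient of the word M_f = w (f : [n] → variables) is the
-- number of choices L of a linear ordering of every block of
-- (ker f) ∧ π.  Positions j,k lie in the same block of (ker f) ∧ π iff
-- they have the same (label, letter) pair, so the blocks correspond to
-- the distinct pairs, and a block B admits |B|! linear orderings.
h : SetPartition → Series
h π w = if length w ≡ᵇ length π
        then prodℚ (map (λ c → ℕ→ℚ (countPair c zs !)) (deduplicateᵇ eqPair zs))
        else 0ℚ
  where zs = zip π w

-- ρ : let the variables commute.  The coefficient of a commutative
-- monomial (represented by a word w) in ρ F is the sum of the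
-- coefficients in F of all distinct words that are rearrangements of w.

words : ℕ → List ℕ → List (List ℕ)
words zero A = [] ∷ []
words (suc n) A = concatMap (λ a → map (a ∷_) (words n A)) A

sameMultiset : List ℕ → List ℕ → Bool
sameMultiset u w = (length u ≡ᵇ length w) ∧ allᵇ (λ x → countᵇ x u ≡ᵇ countᵇ x w) (u ++ w)

rearrangements : List ℕ → List (List ℕ)
rearrangements w = filter (λ u → T? (sameMultiset u w)) (words (length w) (distinct w))

ρ : Series → Series
ρ F w = sumℚ (map F (rearrangements w))

-- product of commutative series: coefficient of a monomial m in F·G is
-- the sum over all decompositions m = m₁ m₂ (as multisets) of
-- F(m₁)·G(m₂).  Sub-multisets are enumerated by choosing for every
-- distinct letter x how many of its occurrences go to m₁.
splits : List ℕ → List ℕ → List (List ℕ × List ℕ)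
splits [] w = ([] , []) ∷ []
splits (x ∷ xs) w =
  concatMap (λ c → map (λ { (u , v) → (replicate c x ++ u , replicate (countᵇ x w ∸ c) x ++ v) }) (splits xs w))
            (upTo (suc (countᵇ x w)))

_⊛_ : Series → Series → Series
(F ⊛ G) w = sumℚ (map (λ { (u , v) → F u * G v }) (splits (distinct w) w))

oneΛ : Series
oneΛ [] = 1ℚ
oneΛ (_ ∷ _) = 0ℚ

eₖ : ℕ → Series
eₖ k w = boolℚ ((length w ≡ᵇ k) ∧ (length (distinct w) ≡ᵇ length w))

hₖ : ℕ → Series
hₖ k w = boolℚ (length w ≡ᵇ k)

IsPartition : List ℕ → Set
IsPartition λs = All (λ k → 0 < k) λs × Linked _≥_ λs

eΛ : List ℕ → Series
eΛ λs = foldr (λ k acc → eₖ k ⊛ acc) oneΛ λs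

hΛ : List ℕ → Series
hΛ λs = foldr (λ k acc → hₖ k ⊛ acc) oneΛ λs

IsLinearOn : (Series → Set) → (Series → Series) → Set
IsLinearOn P ω =
    (∀ F → P F → P (ω F))
  × (∀ F G → P F → P G → F ≈ G → ω F ≈ ω G)
  × (∀ F G → P F → P G → ω (F ⊕ G) ≈ ω F ⊕ ω G)
  × (∀ a F → P F → ω (a • F) ≈ a • ω F)

{-# OPTIONS --safe #-}

-- Read from right to left, the coefficient of e_π at a word w is a product over the positions j of 1 − c_j, and
-- that of h_π a product of 1 + c_j, where c_j counts the later positions with the same label and the same letter
-- as j.  Expanding these products expresses both as sums of power sums p_τ over the same τ ("forests" refining π);
-- the coefficient of p_τ is sgn τ for e_π and 1 for h_π.  Apart from a positive multiple of p_π, every term p_τ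
-- has smaller rank n − #blocks, so by induction on the rank p_π is a combination of e's whose image under ω is
-- sgn π · p_π.  The p_π span Π, so ω is an involution.  For (iii), ρ turns the splitting of π into one block and
-- the rest into a product of commutative series, and ρ sends the e and h of a single block of size k to k! e_k
-- and k! h_k; hence ρ e_π = λ! e_λ and ρ h_π = λ! h_λ for the type λ of π.

module Submission where

open import Defs
open import Data.Bool using (Bool; true; false; T; not; _∧_; _∨_; if_then_else_)
open import Data.Bool.Properties using (T?; T-≡)
import Data.Integer as ℤ
import Data.Integer.Properties as ℤ
open import Data.List using (List; []; _∷_; _++_; map; concatMap; filter; foldr; length; zip; drop; replicate; upTo; applyUpTo; cartesianProduct; deduplicateᵇ)
open import Data.List.Extrema.Nat using (argmax; argmax-sel; f[xs]≤f[argmax])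
open import Data.List.Membership.Propositional using (_∈_; _∉_; find; lose)
open import Data.List.Membership.Propositional.Properties
open import Data.List.Membership.Propositional.Properties.WithK using (unique∧set⇒bag)
open import Data.List.Properties using (filter-all; map-∘; map-id; map-cong; map-injective; map-cong-local; map-upTo; length-filter; length-++; drop-map; ∷-injective)
open import Data.List.Relation.Binary.BagAndSetEquality using (∼bag⇒↭)
open import Data.List.Relation.Binary.Permutation.Propositional using (_↭_; prep; swap; ↭-refl; ↭-sym; ↭-trans; ↭-reflexive)
open import Data.List.Relation.Binary.Permutation.Propositional.Properties using (map⁺; ↭-length; shift; drop-∷; ∈-resp-↭; ++⁺)
open import Data.List.Relation.Unary.All as All using (All; []; _∷_)
import Data.List.Relation.Unary.All.Properties as All
open import Data.List.Relation.Unary.AllPairs as AllPairs using (AllPairs; []; _∷_)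
import Data.List.Relation.Unary.AllPairs.Properties as AllPairs
open import Data.List.Relation.Unary.Any using (here; there)
open import Data.List.Relation.Unary.Linked using (Linked; []; [-]; _∷_)
open import Data.List.Relation.Unary.Unique.Propositional using (Unique)
import Data.List.Relation.Unary.Unique.Propositional.Properties as Unique
open import Data.Nat as ℕ using (ℕ; zero; suc; _≡ᵇ_; _∸_; _!; s≤s; z≤n; _≤_; _<_)
open import Data.Nat.Induction using (<-wellFounded)
open import Data.Nat.ListAction using (sum)
open import Data.Nat.Properties as ℕ using (≡ᵇ⇒≡; ≡⇒≡ᵇ; ≤-refl; ≤-trans)
open import Data.List.Membership.DecPropositional ℕ._≟_ using (_∈?_)
open import Data.Product using (_×_; _,_; proj₁; proj₂; ∃; ∃-syntax; ∃₂)
open import Data.Product.Properties using (,-injectiveˡ; ,-injectiveʳ; ≡-dec)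
open import Data.List.Membership.DecPropositional (≡-dec ℕ._≟_ ℕ._≟_) using () renaming (_∈?_ to _∈ᵖ?_)
open import Data.Rational using (ℚ; 0ℚ; 1ℚ; _+_; _*_; -_; 1/_; toℚᵘ)
import Data.Rational.Properties as ℚ
open import Data.Rational.Solver using (module +-*-Solver)
import Data.Rational.Unnormalised as ℚᵘ
import Data.Rational.Unnormalised.Properties as ℚᵘ
open import Data.Sum using (_⊎_; inj₁; inj₂; [_,_]′)
open import Function.Base using (_∘_; id; case_of_)
open import Function.Bundles using (_↔_; mk↔ₛ′; mk⇔; Inverse; Equivalence)
open import Induction.WellFounded using (Acc; acc)
open import Relation.Binary.PropositionalEquality hiding ([_])
open import Relation.Nullary using (¬_; Reflects; ofʸ; ofⁿ; yes; no; contradiction; does; ¬?; fromEquivalence)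
open import Relation.Unary using (Decidable)
open +-*-Solver using (solve; con; _:=_; _:+_; _:*_; :-_)

-- Finite sums and lists without repetitions

-- `e` and `h` are the values of one series `E ε` at `ε = - 1ℚ` and `ε = 1ℚ`, in which `p τ` has
-- weight `ε ^ rank τ`; one computation therefore serves both. The factors 1 - c may be negative,
-- but never visibly so: as soon as a label and letter repeat, the first repetition met from the
-- right has c = 1 and kills the whole product. The action of ω is traced by derivations of
-- `Lin e h F G`, which build `F` from the `e` and `G` from the `h` by the same linear combination;
-- linearity then gives `ω F ≈ G`. Because signs square to 1, the relation between p_π and sgn π ·
-- p_π can be read in both directions, and this symmetry is what makes ω an involution. That the p_π
-- span Π is shown by induction on the degree, stripping the first letter of a word: it is either
-- new to the rest of the word or equal to the letter at some position there, and each case has a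
-- coefficient that is again a symmetric series in the rest.

∑ : {A : Set} → List A → (A → ℚ) → ℚ
∑ xs f = sumℚ (map f xs)

module _ {A : Set} where

  ∑-cong : ∀ (xs : List A) {f g} → (∀ {x} → x ∈ xs → f x ≡ g x) → ∑ xs f ≡ ∑ xs g
  ∑-cong []       eq = refl
  ∑-cong (x ∷ xs) eq = cong₂ _+_ (eq (here refl)) (∑-cong xs (eq ∘ there))

  ∑-zero : ∀ (xs : List A) {f} → (∀ {x} → x ∈ xs → f x ≡ 0ℚ) → ∑ xs f ≡ 0ℚ
  ∑-zero []       eq = refl
  ∑-zero (x ∷ xs) eq = cong₂ _+_ (eq (here refl)) (∑-zero xs (eq ∘ there))

  ∑-distrib-+ : ∀ (xs : List A) f g → ∑ xs (λ x → f x + g x) ≡ ∑ xs f + ∑ xs g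
  ∑-distrib-+ []       f g = refl
  ∑-distrib-+ (x ∷ xs) f g = trans (cong (f x + g x +_) (∑-distrib-+ xs f g))
    (solve 4 (λ a b c d → (a :+ b) :+ (c :+ d) := (a :+ c) :+ (b :+ d)) refl
      (f x) (g x) (∑ xs f) (∑ xs g))

  ∑-*ˡ : ∀ a (xs : List A) f → ∑ xs (λ x → a * f x) ≡ a * ∑ xs f
  ∑-*ˡ a []       f = sym (ℚ.*-zeroʳ a)
  ∑-*ˡ a (x ∷ xs) f = trans (cong (a * f x +_) (∑-*ˡ a xs f)) (sym (ℚ.*-distribˡ-+ a _ _))

  ∑-*ʳ : ∀ (xs : List A) f a → ∑ xs (λ x → f x * a) ≡ ∑ xs f * a
  ∑-*ʳ xs f a = trans (∑-cong xs λ {x} _ → ℚ.*-comm (f x) a) (trans (∑-*ˡ a xs f) (ℚ.*-comm a _))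

  ∑-++ : ∀ (xs ys : List A) f → ∑ (xs ++ ys) f ≡ ∑ xs f + ∑ ys f
  ∑-++ []       ys f = sym (ℚ.+-identityˡ _)
  ∑-++ (x ∷ xs) ys f = trans (cong (f x +_) (∑-++ xs ys f)) (sym (ℚ.+-assoc (f x) _ _))

  ∑-↭ : ∀ {xs ys : List A} f → xs ↭ ys → ∑ xs f ≡ ∑ ys f
  ∑-↭ f _↭_.refl         = refl
  ∑-↭ f (prep x p)   = cong (f x +_) (∑-↭ f p)
  ∑-↭ f (swap x y p) = trans (cong (λ s → f x + (f y + s)) (∑-↭ f p))
    (solve 3 (λ a b c → a :+ (b :+ c) := b :+ (a :+ c)) refl (f x) (f y) _)
  ∑-↭ f (_↭_.trans p q)  = trans (∑-↭ f p) (∑-↭ f q)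

  ∑-filter : ∀ {P : A → Set} (P? : Decidable P) (xs : List A) f →
             (∀ {x} → x ∈ xs → ¬ P x → f x ≡ 0ℚ) → ∑ (filter P? xs) f ≡ ∑ xs f
  ∑-filter P? []       f zero! = refl
  ∑-filter P? (x ∷ xs) f zero! with P? x
  ... | yes _  = cong (f x +_) (∑-filter P? xs f (zero! ∘ there))
  ... | no ¬px = trans (∑-filter P? xs f (zero! ∘ there))
                   (trans (sym (ℚ.+-identityˡ _)) (cong (_+ ∑ xs f) (sym (zero! (here refl) ¬px))))

∑-map : ∀ {A B : Set} (g : A → B) xs f → ∑ (map g xs) f ≡ ∑ xs (f ∘ g)
∑-map g xs f = cong sumℚ (sym (map-∘ xs))

∑-concatMap : ∀ {A B : Set} (g : A → List B) xs f → ∑ (concatMap g xs) f ≡ ∑ xs (λ x → ∑ (g x) f)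
∑-concatMap g []       f = refl
∑-concatMap g (x ∷ xs) f = trans (∑-++ (g x) _ f) (cong (∑ (g x) f +_) (∑-concatMap g xs f))

prodℚ-↭ : ∀ {xs ys} → xs ↭ ys → prodℚ xs ≡ prodℚ ys
prodℚ-↭ _↭_.refl        = refl
prodℚ-↭ (prep x p)  = cong (x *_) (prodℚ-↭ p)
prodℚ-↭ (swap x y p) = trans (cong (λ s → x * (y * s)) (prodℚ-↭ p))
  (solve 3 (λ a b c → a :* (b :* c) := b :* (a :* c)) refl x y _)
prodℚ-↭ (_↭_.trans p q) = trans (prodℚ-↭ p) (prodℚ-↭ q)

unique⇒↭ : ∀ {A : Set} {xs ys : List A} → Unique xs → Unique ys →
           (∀ {z} → z ∈ xs → z ∈ ys) → (∀ {z} → z ∈ ys → z ∈ xs) → xs ↭ ys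
unique⇒↭ xs! ys! ⊆ ⊇ = ∼bag⇒↭ (unique∧set⇒bag xs! ys! (mk⇔ ⊆ ⊇))

module Deduplicate {A : Set} (_==_ : A → A → Bool) (reflects : ∀ x y → Reflects (x ≡ y) (x == y)) where

  ==⇒≡ : ∀ {x y} → T (x == y) → x ≡ y
  ==⇒≡ {x} {y} t with x == y | reflects x y
  ... | true | ofʸ eq = eq

  ≡⇒== : ∀ {x y} → x ≡ y → T (x == y)
  ≡⇒== {x} {y} eq with x == y | reflects x y
  ... | true  | _ = _
  ... | false | ofⁿ ¬eq = ¬eq eq

  remove : A → List A → List A
  remove x = filter (¬? ∘ λ y → T? (x == y))

  remove-∉ : ∀ {x xs} → x ∉ xs → remove x xs ≡ xs
  remove-∉ x∉ = filter-all _ (All.tabulate λ y∈ t → x∉ (subst (_∈ _) (sym (==⇒≡ t)) y∈))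

  dedup : List A → List A
  dedup = deduplicateᵇ _==_

  dedup-! : ∀ xs → Unique (dedup xs)
  dedup-! []       = []
  dedup-! (x ∷ xs) = All.map (_∘ ≡⇒==) (All.all-filter _ (dedup xs)) ∷ Unique.filter⁺ _ (dedup-! xs)

  ∈-dedup⁻ : ∀ {z} xs → z ∈ dedup xs → z ∈ xs
  ∈-dedup⁻ (x ∷ xs) (here eq) = here eq
  ∈-dedup⁻ (x ∷ xs) (there z∈) = there (∈-dedup⁻ xs (proj₁ (∈-filter⁻ _ {xs = dedup xs} z∈)))

  ∈-dedup⁺ : ∀ {z} xs → z ∈ xs → z ∈ dedup xs
  ∈-dedup⁺ (x ∷ xs) (here eq) = here eq
  ∈-dedup⁺ {z} (x ∷ xs) (there z∈) with T? (x == z)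
  ... | yes t = here (sym (==⇒≡ t))
  ... | no ¬t = there (∈-filter⁺ _ (∈-dedup⁺ xs z∈) ¬t)

  dedup-∈ : ∀ {x} xs → x ∈ xs → dedup xs ↭ dedup (x ∷ xs)
  dedup-∈ {x} xs x∈ = unique⇒↭ (dedup-! xs) (dedup-! (x ∷ xs))
    (∈-dedup⁺ (x ∷ xs) ∘ there ∘ ∈-dedup⁻ xs)
    (λ z∈ → case ∈-dedup⁻ (x ∷ xs) z∈ of λ where
      (here refl)  → ∈-dedup⁺ xs x∈
      (there z∈xs) → ∈-dedup⁺ xs z∈xs)

  dedup-∉ : ∀ {x} xs → x ∉ xs → dedup (x ∷ xs) ≡ x ∷ dedup xs
  dedup-∉ {x} xs x∉ = cong (x ∷_) (remove-∉ (x∉ ∘ ∈-dedup⁻ xs))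

≡ᵇ-reflects : ∀ m n → Reflects (m ≡ n) (m ≡ᵇ n)
≡ᵇ-reflects m n = fromEquivalence (≡ᵇ⇒≡ m n) (≡⇒≡ᵇ m n)

≡ᵇ-refl : ∀ n → (n ≡ᵇ n) ≡ true
≡ᵇ-refl n = Equivalence.to T-≡ (≡⇒≡ᵇ n n refl)

≢⇒≡ᵇ-false : ∀ {m n} → m ≢ n → (m ≡ᵇ n) ≡ false
≢⇒≡ᵇ-false {m} {n} m≢n with m ≡ᵇ n | ≡ᵇ-reflects m n
... | true  | ofʸ m≡n = contradiction m≡n m≢n
... | false | _       = refl

eqPair-reflects : ∀ z z′ → Reflects (z ≡ z′) (eqPair z z′)
eqPair-reflects (a , b) (c , d) with a ≡ᵇ c | ≡ᵇ-reflects a c | b ≡ᵇ d | ≡ᵇ-reflects b d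
... | true  | ofʸ refl | true  | ofʸ refl = ofʸ refl
... | true  | ofʸ refl | false | ofⁿ b≢d  = ofⁿ (b≢d ∘ ,-injectiveʳ)
... | false | ofⁿ a≢c  | _     | _        = ofⁿ (a≢c ∘ ,-injectiveˡ)

module Distinct = Deduplicate _≡ᵇ_ ≡ᵇ-reflects
module DistinctPairs = Deduplicate eqPair eqPair-reflects

ℕ→ℚ-homo-+ : ∀ m n → ℕ→ℚ (m ℕ.+ n) ≡ ℕ→ℚ m + ℕ→ℚ n
ℕ→ℚ-homo-+ m n = ℚ.toℚᵘ-injective (begin
  toℚᵘ (ℕ→ℚ (m ℕ.+ n))              ≈⟨ ℚ.toℚᵘ-fromℚᵘ (ℚᵘ.mkℚᵘ (ℤ.+ (m ℕ.+ n)) 0) ⟩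
  ℚᵘ.mkℚᵘ (ℤ.+ (m ℕ.+ n)) 0           ≈⟨ ℚᵘ.*≡* (cong (λ k → k ℤ.* ℤ.+ 1)
                                         (sym (cong₂ ℤ._+_ (ℤ.*-identityʳ (ℤ.+ m)) (ℤ.*-identityʳ (ℤ.+ n))))) ⟩
  ℚᵘ.mkℚᵘ (ℤ.+ m) 0 ℚᵘ.+ ℚᵘ.mkℚᵘ (ℤ.+ n) 0
    ≈⟨ ℚᵘ.+-cong (ℚᵘ.≃-sym (ℚ.toℚᵘ-fromℚᵘ (ℚᵘ.mkℚᵘ (ℤ.+ m) 0))) (ℚᵘ.≃-sym (ℚ.toℚᵘ-fromℚᵘ (ℚᵘ.mkℚᵘ (ℤ.+ n) 0))) ⟩
  toℚᵘ (ℕ→ℚ m) ℚᵘ.+ toℚᵘ (ℕ→ℚ n)    ≈⟨ ℚᵘ.≃-sym (ℚ.toℚᵘ-homo-+ (ℕ→ℚ m) (ℕ→ℚ n)) ⟩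
  toℚᵘ (ℕ→ℚ m + ℕ→ℚ n)              ∎)
  where open ℚᵘ.≃-Reasoning

ℕ→ℚ-homo-* : ∀ m n → ℕ→ℚ (m ℕ.* n) ≡ ℕ→ℚ m * ℕ→ℚ n
ℕ→ℚ-homo-* zero    n = sym (ℚ.*-zeroˡ (ℕ→ℚ n))
ℕ→ℚ-homo-* (suc m) n = begin
  ℕ→ℚ (n ℕ.+ m ℕ.* n)        ≡⟨ ℕ→ℚ-homo-+ n (m ℕ.* n) ⟩
  ℕ→ℚ n + ℕ→ℚ (m ℕ.* n)      ≡⟨ cong (ℕ→ℚ n +_) (ℕ→ℚ-homo-* m n) ⟩
  ℕ→ℚ n + ℕ→ℚ m * ℕ→ℚ n      ≡⟨ solve 2 (λ a b → b :+ a :* b := (con 1ℚ :+ a) :* b) refl (ℕ→ℚ m) (ℕ→ℚ n) ⟩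
  (1ℚ + ℕ→ℚ m) * ℕ→ℚ n       ≡⟨ cong (_* ℕ→ℚ n) (sym (ℕ→ℚ-homo-+ 1 m)) ⟩
  ℕ→ℚ (suc m) * ℕ→ℚ n        ∎
  where open ≡-Reasoning

-- A common family containing `e` and `h`

factor : ℚ → ℕ → ℚ
factor ε n = 1ℚ + ε * ℕ→ℚ n

E : ℚ → SetPartition → Series
E ε []      []      = 1ℚ
E ε []      (_ ∷ _) = 0ℚ
E ε (_ ∷ _) []      = 0ℚ
E ε (b ∷ π) (x ∷ w) = E ε π w * factor ε (countPair (b , x) (zip π w))

E-length : ∀ ε π w → length w ≢ length π → E ε π w ≡ 0ℚ
E-length ε []      []      ≢ = contradiction refl ≢
E-length ε []      (_ ∷ _) ≢ = refl
E-length ε (_ ∷ _) []      ≢ = refl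
E-length ε (b ∷ π) (x ∷ w) ≢ = trans (cong (_* f) (E-length ε π w (≢ ∘ cong suc))) (ℚ.*-zeroˡ f)
  where f = factor ε (countPair (b , x) (zip π w))

allᵇ-eCoeffOK⇒count≡0 : ∀ z zs → allᵇ (eCoeffOK z) zs ≡ true → countPair z zs ≡ 0
allᵇ-eCoeffOK⇒count≡0 z []       eq = refl
allᵇ-eCoeffOK⇒count≡0 z (y ∷ ys) eq with eqPair z y
... | false = allᵇ-eCoeffOK⇒count≡0 z ys eq

-- Since the pairs in `zs` do not clash among themselves, `z` occurs there at most once; a clash
-- therefore means exactly once, and the factor `1 - 1` is the zero that `e` demands. Larger counts
-- only arise where `e` of the tail is already 0.
¬allᵇ-eCoeffOK⇒count≡1 : ∀ z zs → pairwise eCoeffOK zs ≡ true →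
                         allᵇ (eCoeffOK z) zs ≡ false → countPair z zs ≡ 1
¬allᵇ-eCoeffOK⇒count≡1 z (y ∷ ys) pw eq
  with eqPair z y | eqPair-reflects z y | allᵇ (eCoeffOK y) ys in eqy | pw
... | true  | ofʸ refl | true | _   = cong suc (allᵇ-eCoeffOK⇒count≡0 z ys eqy)
... | false | _        | true | pw′ = ¬allᵇ-eCoeffOK⇒count≡1 z ys pw′ eq

boolℚ-factor : ∀ l a q {k} → (a ≡ true → k ≡ 0) → (q ≡ true → a ≡ false → k ≡ 1) →
               boolℚ (l ∧ (a ∧ q)) ≡ boolℚ (l ∧ q) * factor (- 1ℚ) k
boolℚ-factor false a     q     {k} _  _  = sym (ℚ.*-zeroˡ (factor (- 1ℚ) k))
boolℚ-factor true  false false {k} _  _  = sym (ℚ.*-zeroˡ (factor (- 1ℚ) k))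
boolℚ-factor true  true  false {k} _  _  = sym (ℚ.*-zeroˡ (factor (- 1ℚ) k))
boolℚ-factor true  true  true      k0 _  = cong (λ k → 1ℚ * factor (- 1ℚ) k) (sym (k0 refl))
boolℚ-factor true  false true      _  k1 = cong (λ k → 1ℚ * factor (- 1ℚ) k) (sym (k1 refl refl))

e-∷ : ∀ b π x w → e (b ∷ π) (x ∷ w) ≡ e π w * factor (- 1ℚ) (countPair (b , x) (zip π w))
e-∷ b π x w = boolℚ-factor (length w ≡ᵇ length π) (allᵇ (eCoeffOK (b , x)) (zip π w)) (pairwise eCoeffOK (zip π w))
  (allᵇ-eCoeffOK⇒count≡0 (b , x) (zip π w)) (¬allᵇ-eCoeffOK⇒count≡1 (b , x) (zip π w))

e≈E : ∀ π → e π ≈ E (- 1ℚ) π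
e≈E []      []      = refl
e≈E []      (_ ∷ _) = refl
e≈E (_ ∷ _) []      = refl
e≈E (b ∷ π) (x ∷ w) = trans (e-∷ b π x w) (cong (_* factor (- 1ℚ) (countPair (b , x) (zip π w))) (e≈E π w))

countPair-∉ : ∀ z zs → z ∉ zs → countPair z zs ≡ 0
countPair-∉ z []       z∉ = refl
countPair-∉ z (y ∷ ys) z∉ with eqPair z y | eqPair-reflects z y
... | true  | ofʸ z≡y = contradiction (here z≡y) z∉
... | false | _       = countPair-∉ z ys (z∉ ∘ there)

#orderings : List (ℕ × ℕ) → ℚ
#orderings zs = prodℚ (map (λ c → ℕ→ℚ (countPair c zs !)) (deduplicateᵇ eqPair zs))

-- One more copy of `z` turns its factor `k !` into `(1 + k) * k !` and leaves the factors of all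
-- other pairs alone.
#orderings-∷ : ∀ z zs → #orderings (z ∷ zs) ≡ #orderings zs * factor 1ℚ (countPair z zs)
#orderings-∷ z zs = begin
  ℕ→ℚ (countPair z (z ∷ zs) !) * prodℚ (map (f (z ∷ zs)) others)
    ≡⟨ cong₂ (λ n s → ℕ→ℚ (n !) * prodℚ s) count-z
         (map-cong-local (All.tabulate (cong (ℕ→ℚ ∘ _!) ∘ count-other))) ⟩
  ℕ→ℚ (suc k ℕ.* k !) * P
    ≡⟨ cong (_* P) (trans (ℕ→ℚ-homo-* (suc k) (k !)) (cong (_* ℕ→ℚ (k !)) (ℕ→ℚ-homo-+ 1 k))) ⟩
  (1ℚ + ℕ→ℚ k) * ℕ→ℚ (k !) * P
    ≡⟨ solve 3 (λ a b c → (con 1ℚ :+ a) :* b :* c := b :* c :* (con 1ℚ :+ con 1ℚ :* a)) refl (ℕ→ℚ k) (ℕ→ℚ (k !)) P ⟩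
  (ℕ→ℚ (k !) * P) * factor 1ℚ k
    ≡⟨ cong (_* factor 1ℚ k) (sym split) ⟩
  #orderings zs * factor 1ℚ k ∎
  where
  open ≡-Reasoning
  open DistinctPairs
  f : List (ℕ × ℕ) → ℕ × ℕ → ℚ
  f zs c = ℕ→ℚ (countPair c zs !)
  k = countPair z zs
  others = remove z (dedup zs)
  P = prodℚ (map (f zs) others)

  count-z : countPair z (z ∷ zs) ≡ suc k
  count-z with eqPair z z | eqPair-reflects z z
  ... | true  | _      = refl
  ... | false | ofⁿ ¬r = contradiction refl ¬r

  count-other : ∀ {c} → c ∈ others → countPair c (z ∷ zs) ≡ countPair c zs
  count-other {c} c∈ with eqPair c z | eqPair-reflects c z
  ... | false | _        = refl
  ... | true  | ofʸ refl = contradiction (≡⇒== {c} refl) (proj₂ (∈-filter⁻ _ {xs = dedup zs} c∈))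


  split : #orderings zs ≡ ℕ→ℚ (k !) * P
  split with z ∈ᵖ? zs
  ... | yes z∈ = prodℚ-↭ (map⁺ (f zs) (dedup-∈ zs z∈))
  -- A new pair has `k = 0`, so its factor `0 !` is 1 and may be inserted.
  ... | no z∉ = begin
    prodℚ (map (f zs) (dedup zs))  ≡⟨ cong (prodℚ ∘ map (f zs)) (sym (remove-∉ (z∉ ∘ ∈-dedup⁻ zs))) ⟩
    P                              ≡⟨ sym (ℚ.*-identityˡ P) ⟩
    1ℚ * P                         ≡⟨ cong (λ n → ℕ→ℚ (n !) * P) (sym (countPair-∉ z zs z∉)) ⟩
    ℕ→ℚ (k !) * P                  ∎

if-* : ∀ b {x y} a → x ≡ y * a → (if b then x else 0ℚ) ≡ (if b then y else 0ℚ) * a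
if-* true  a eq = eq
if-* false a eq = sym (ℚ.*-zeroˡ a)

h≈E : ∀ π → h π ≈ E 1ℚ π
h≈E []      []      = refl
h≈E []      (_ ∷ _) = refl
h≈E (_ ∷ _) []      = refl
h≈E (b ∷ π) (x ∷ w) = trans
  (if-* (length w ≡ᵇ length π) f (#orderings-∷ (b , x) (zip π w)))
  (cong (_* f) (h≈E π w))
  where f = factor 1ℚ (countPair (b , x) (zip π w))

-- Expansion into power sums

rank : SetPartition → ℕ
rank π = length π ∸ #blocks π

#blocks-∈ : ∀ {b} π → b ∈ π → #blocks (b ∷ π) ≡ #blocks π
#blocks-∈ π b∈ = sym (↭-length (Distinct.dedup-∈ π b∈))

#blocks-∉ : ∀ {b} π → b ∉ π → #blocks (b ∷ π) ≡ suc (#blocks π)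
#blocks-∉ π b∉ = cong length (Distinct.dedup-∉ π b∉)

#blocks≤length : ∀ π → #blocks π ≤ length π
#blocks≤length []      = z≤n
#blocks≤length (b ∷ π) = s≤s (≤-trans (length-filter _ (distinct π)) (#blocks≤length π))

rank-∈ : ∀ {b} π → b ∈ π → rank (b ∷ π) ≡ suc (rank π)
rank-∈ π b∈ = trans (cong (suc (length π) ∸_) (#blocks-∈ π b∈)) (ℕ.+-∸-assoc 1 (#blocks≤length π))

rank-∉ : ∀ {b} π → b ∉ π → rank (b ∷ π) ≡ rank π
rank-∉ π b∉ = cong (suc (length π) ∸_) (#blocks-∉ π b∉)

boolℚ-∧ : ∀ a b → boolℚ (a ∧ b) ≡ boolℚ a * boolℚ b
boolℚ-∧ true  b = sym (ℚ.*-identityˡ (boolℚ b))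
boolℚ-∧ false b = sym (ℚ.*-zeroˡ (boolℚ b))

p-length : ∀ π w → length w ≢ length π → p π w ≡ 0ℚ
p-length π w ≢ rewrite ≢⇒≡ᵇ-false ≢ = refl

p-∷ : ∀ b π x w → p (b ∷ π) (x ∷ w) ≡ p π w * boolℚ (allᵇ (pCoeffOK (b , x)) (zip π w))
p-∷ b π x w with length w ≡ᵇ length π
... | false = sym (ℚ.*-zeroˡ (boolℚ (allᵇ (pCoeffOK (b , x)) (zip π w))))
... | true  = trans (boolℚ-∧ A P) (ℚ.*-comm (boolℚ A) (boolℚ P))
  where A = allᵇ (pCoeffOK (b , x)) (zip π w)
        P = pairwise pCoeffOK (zip π w)

module _ {A : Set} {P : A → Bool} where

  allᵇ⁺ : ∀ xs → (∀ {x} → x ∈ xs → P x ≡ true) → allᵇ P xs ≡ true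
  allᵇ⁺ []       P! = refl
  allᵇ⁺ (x ∷ xs) P! rewrite P! (here refl) = allᵇ⁺ xs (P! ∘ there)

  allᵇ⁻ : ∀ {x xs} → allᵇ P xs ≡ true → x ∈ xs → P x ≡ true
  allᵇ⁻ {xs = y ∷ ys} eq (here refl) with true ← P y = refl
  allᵇ⁻ {xs = y ∷ ys} eq (there x∈)  with true ← P y = allᵇ⁻ eq x∈

∈-zip⁻ : ∀ {a x : ℕ} π (w : List ℕ) → (a , x) ∈ zip π w → a ∈ π
∈-zip⁻ (_ ∷ π) (_ ∷ w) (here eq)  = here (,-injectiveˡ eq)
∈-zip⁻ (_ ∷ π) (_ ∷ w) (there a∈) = there (∈-zip⁻ π w a∈)

pCoeffOK-sym : ∀ z z′ → pCoeffOK z z′ ≡ true → pCoeffOK z′ z ≡ true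
pCoeffOK-sym (b , x) (b′ , x′) eq with b ≡ᵇ b′ | ≡ᵇ-reflects b b′
... | false | ofⁿ b≢b′ rewrite ≢⇒≡ᵇ-false (b≢b′ ∘ sym) = refl
... | true  | ofʸ refl with true ← x ≡ᵇ x′ | ofʸ refl ← ≡ᵇ-reflects x x′ rewrite ≡ᵇ-refl b | ≡ᵇ-refl x = refl

pairwise⁻ : ∀ {z z′} zs → pairwise pCoeffOK zs ≡ true → z ∈ zs → z′ ∈ zs → pCoeffOK z z′ ≡ true
pairwise⁻ {b , x} (y ∷ ys) pw z∈ z′∈ with allᵇ (pCoeffOK y) ys in all | pw | z∈ | z′∈
... | true | _   | here refl | here refl rewrite ≡ᵇ-refl b | ≡ᵇ-refl x = refl
... | true | _   | here refl | there z′∈ = allᵇ⁻ all z′∈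
... | true | _   | there z∈  | here refl = pCoeffOK-sym y _ (allᵇ⁻ all z∈)
... | true | pw′ | there z∈  | there z′∈ = pairwise⁻ ys pw′ z∈ z′∈

p-∷-∉ : ∀ {b} π x w → b ∉ π → p (b ∷ π) (x ∷ w) ≡ p π w
p-∷-∉ {b} π x w b∉ = begin
  p (b ∷ π) (x ∷ w)                                    ≡⟨ p-∷ b π x w ⟩
  p π w * boolℚ (allᵇ (pCoeffOK (b , x)) (zip π w))    ≡⟨ cong (λ a → p π w * boolℚ a) (allᵇ⁺ (zip π w) other) ⟩
  p π w * 1ℚ                                           ≡⟨ ℚ.*-identityʳ (p π w) ⟩
  p π w                                                ∎
  where
  open ≡-Reasoning
  other : ∀ {z} → z ∈ zip π w → pCoeffOK (b , x) z ≡ true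
  other z∈ rewrite ≢⇒≡ᵇ-false {b} (λ b≡ → b∉ (subst (_∈ π) (sym b≡) (∈-zip⁻ π w z∈))) = refl

-- One later position with label `b` is enough to test: if `p π w` is 1, all positions labelled `b`
-- already carry the letter `y`, and if it is 0, both sides vanish.
p-∷-∈ : ∀ {b y} π x w → (b , y) ∈ zip π w → p (b ∷ π) (x ∷ w) ≡ p π w * boolℚ (x ≡ᵇ y)
p-∷-∈ {b} {y} π x w b∈ = trans (p-∷ b π x w) step
  where
  same : pairwise pCoeffOK (zip π w) ≡ true → allᵇ (pCoeffOK (b , x)) (zip π w) ≡ (x ≡ᵇ y)
  same pw with x ≡ᵇ y | ≡ᵇ-reflects x y
  ... | true  | ofʸ refl = allᵇ⁺ (zip π w) (pairwise⁻ (zip π w) pw b∈)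
  ... | false | ofⁿ x≢y with allᵇ (pCoeffOK (b , x)) (zip π w) in all
  ...   | false = refl
  ...   | true with eq ← allᵇ⁻ all b∈ rewrite ≡ᵇ-refl b | ≢⇒≡ᵇ-false x≢y with () ← eq

  step : p π w * boolℚ (allᵇ (pCoeffOK (b , x)) (zip π w)) ≡ p π w * boolℚ (x ≡ᵇ y)
  step with length w ≡ᵇ length π | pairwise pCoeffOK (zip π w) in pw
  ... | true  | true  = cong (λ a → 1ℚ * boolℚ a) (same pw)
  ... | true  | false = trans (ℚ.*-zeroˡ (boolℚ (allᵇ (pCoeffOK (b , x)) (zip π w)))) (sym (ℚ.*-zeroˡ (boolℚ (x ≡ᵇ y))))
  ... | false | _     = trans (ℚ.*-zeroˡ (boolℚ (allᵇ (pCoeffOK (b , x)) (zip π w)))) (sym (ℚ.*-zeroˡ (boolℚ (x ≡ᵇ y))))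

fresh : List ℕ → ℕ
fresh xs = suc (sum xs)

fresh-∉ : ∀ xs → fresh xs ∉ xs
fresh-∉ xs fresh∈ = ℕ.<-irrefl refl (∈⇒≤sum xs fresh∈)
  where
  ∈⇒≤sum : ∀ {x} xs → x ∈ xs → x ≤ sum xs
  ∈⇒≤sum (_ ∷ xs) (here refl) = ℕ.m≤m+n _ (sum xs)
  ∈⇒≤sum (y ∷ xs) (there x∈)  = ≤-trans (∈⇒≤sum xs x∈) (ℕ.m≤n+m _ y)

-- There is one entry for each position labelled `b` in `π`, with repetitions kept, so that a sum
-- over the list counts positions and not blocks of `τ`.
pick : ℕ → SetPartition → SetPartition → List ℕ
pick b []      _       = []
pick b (_ ∷ _) []      = []
pick b (c ∷ π) (t ∷ τ) = if b ≡ᵇ c then t ∷ pick b π τ else pick b π τ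

attach : ℕ → SetPartition → SetPartition → List SetPartition
attach b π τ = (fresh τ ∷ τ) ∷ map (_∷ τ) (pick b π τ)

-- Expanding the product defining E amounts to letting every position either
-- start a new block or join the block of a later position carrying the same label.
forests : SetPartition → List SetPartition
forests []      = [] ∷ []
forests (b ∷ π) = concatMap (attach b π) (forests π)

∈-pick⁻ : ∀ {t} b π τ (w : List ℕ) → length τ ≡ length π → length w ≡ length π → t ∈ pick b π τ →
          ∃[ y ] (t , y) ∈ zip τ w × (b , y) ∈ zip π w
∈-pick⁻ b (c ∷ π) (s ∷ τ) (x ∷ w) lτ lw t∈ with b ≡ᵇ c | ≡ᵇ-reflects b c | t∈
... | true  | ofʸ refl | here refl = x , here refl , here refl
... | true  | _        | there t∈′ =
  let y , tz , bz = ∈-pick⁻ b π τ w (ℕ.suc-injective lτ) (ℕ.suc-injective lw) t∈′ in y , there tz , there bz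
... | false | _        | t∈′ =
  let y , tz , bz = ∈-pick⁻ b π τ w (ℕ.suc-injective lτ) (ℕ.suc-injective lw) t∈′ in y , there tz , there bz

pick-nonempty : ∀ b π τ → length τ ≡ length π → b ∈ π → ∃ (_∈ pick b π τ)
pick-nonempty b (c ∷ π) (s ∷ τ) lτ b∈ with b ≡ᵇ c | ≡ᵇ-reflects b c | b∈
... | true  | _       | _         = s , here refl
... | false | ofⁿ b≢c | here b≡c  = contradiction b≡c b≢c
... | false | _       | there b∈′ = pick-nonempty b π τ (ℕ.suc-injective lτ) b∈′

∑-if-∷ : ∀ (s q : Bool) {a k} t ts (f : ℕ → ℚ) → f t ≡ a * boolℚ q → ∑ ts f ≡ a * ℕ→ℚ k →
         ∑ (if s then t ∷ ts else ts) f ≡ a * ℕ→ℚ (if s ∧ q then suc k else k)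
∑-if-∷ false q     t ts f ft≡ ∑≡ = ∑≡
∑-if-∷ true  false {a} {k} t ts f ft≡ ∑≡ =
  trans (cong₂ _+_ (trans ft≡ (ℚ.*-zeroʳ a)) ∑≡) (ℚ.+-identityˡ (a * ℕ→ℚ k))
∑-if-∷ true  true  {a} {k} t ts f ft≡ ∑≡ = trans (cong₂ _+_ ft≡ ∑≡)
  (trans (sym (ℚ.*-distribˡ-+ a 1ℚ (ℕ→ℚ k))) (cong (a *_) (sym (ℕ→ℚ-homo-+ 1 k))))

-- Joining a position with letter `y` multiplies `p τ w` by the truth value of `x = y`, so exactly
-- the positions with label `b` and letter `x` count. The recursion shortens `π₁`, `τ₁` and `w₁`
-- while `τ` and `w` stay whole; the inclusion of the zips ties them together.
∑-pick : ∀ {τ w} b x π₁ τ₁ w₁ → length τ₁ ≡ length π₁ → length w₁ ≡ length π₁ → (∀ {z} → z ∈ zip τ₁ w₁ → z ∈ zip τ w) →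
         ∑ (pick b π₁ τ₁) (λ t → p (t ∷ τ) (x ∷ w)) ≡ p τ w * ℕ→ℚ (countPair (b , x) (zip π₁ w₁))
∑-pick {τ} {w} b x []       τ₁       w₁       lτ lw ⊆ = sym (ℚ.*-zeroʳ (p τ w))
∑-pick {τ} {w} b x (c ∷ π₁) (t ∷ τ₁) (y ∷ w₁) lτ lw ⊆ =
  ∑-if-∷ (b ≡ᵇ c) (x ≡ᵇ y) {p τ w} {countPair (b , x) (zip π₁ w₁)} t (pick b π₁ τ₁) (λ t → p (t ∷ τ) (x ∷ w)) (p-∷-∈ τ x w (⊆ (here refl)))
    (∑-pick {τ} {w} b x π₁ τ₁ w₁ (ℕ.suc-injective lτ) (ℕ.suc-injective lw) (⊆ ∘ there))

∈-attach⁻ : ∀ {σ} b π τ → σ ∈ attach b π τ → σ ≡ fresh τ ∷ τ ⊎ (∃[ t ] t ∈ pick b π τ × σ ≡ t ∷ τ)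
∈-attach⁻ b π τ (here σ≡)  = inj₁ σ≡
∈-attach⁻ b π τ (there σ∈) = inj₂ (∈-map⁻ (_∷ τ) σ∈)

∈-forests⁻ : ∀ {σ} b π → σ ∈ forests (b ∷ π) → ∃[ τ ] τ ∈ forests π × σ ∈ attach b π τ
∈-forests⁻ b π σ∈ = find (∈-concatMap⁻ (attach b π) {xs = forests π} σ∈)

forests-length : ∀ {τ} π → τ ∈ forests π → length τ ≡ length π
forests-length []      (here refl) = refl
forests-length (b ∷ π) σ∈ with ∈-forests⁻ b π σ∈
... | τ , τ∈ , σ∈′ with ∈-attach⁻ b π τ σ∈′
...   | inj₁ refl           = cong suc (forests-length π τ∈)
...   | inj₂ (t , _ , refl) = cong suc (forests-length π τ∈)

infixr 8 _^_
_^_ : ℚ → ℕ → ℚ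
ε ^ zero  = 1ℚ
ε ^ suc n = ε * ε ^ n

∈-pick⇒∈ : ∀ {t} b π τ → length τ ≡ length π → t ∈ pick b π τ → t ∈ τ × b ∈ π
∈-pick⇒∈ b π τ lτ t∈ =
  let _ , tz , bz = ∈-pick⁻ b π τ τ lτ lτ t∈ in ∈-zip⁻ τ τ tz , ∈-zip⁻ π τ bz

-- In `1 + ε * c` the 1 stands for a new block, which keeps the rank, and each of the `c` copies of
-- `ε` for joining a position with the same label and letter, which raises the rank by one. Joining
-- a position with another letter gives coefficient 0, so all joins may be summed.
E-expand : ∀ ε π → E ε π ≈ λ w → ∑ (forests π) (λ τ → ε ^ rank τ * p τ w)
E-expand ε π w with length w ℕ.≟ length π
... | no  l≢ = trans (E-length ε π w l≢) (sym (∑-zero (forests π) λ {τ} τ∈ →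
                 trans (cong (ε ^ rank τ *_) (p-length τ w (l≢ ∘ λ l → trans l (forests-length π τ∈))))
                       (ℚ.*-zeroʳ (ε ^ rank τ))))
... | yes l≡ = expand π w l≡
  where
  open ≡-Reasoning
  expand : ∀ π w → length w ≡ length π → E ε π w ≡ ∑ (forests π) (λ τ → ε ^ rank τ * p τ w)
  expand []      []      _ = refl
  expand (b ∷ π) (x ∷ w) l = sym (begin
    ∑ (forests (b ∷ π)) (λ σ → ε ^ rank σ * p σ (x ∷ w))
      ≡⟨ ∑-concatMap (attach b π) (forests π) _ ⟩
    ∑ (forests π) (λ τ → ∑ (attach b π τ) (λ σ → ε ^ rank σ * p σ (x ∷ w)))
      ≡⟨ ∑-cong (forests π) (λ {τ} τ∈ → attached τ (forests-length π τ∈)) ⟩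
    ∑ (forests π) (λ τ → ε ^ rank τ * p τ w * f)
      ≡⟨ ∑-*ʳ (forests π) _ f ⟩
    ∑ (forests π) (λ τ → ε ^ rank τ * p τ w) * f
      ≡⟨ cong (_* f) (sym (expand π w (ℕ.suc-injective l))) ⟩
    E ε π w * f ∎)
    where
    k = countPair (b , x) (zip π w)
    f = factor ε k
    attached : ∀ τ → length τ ≡ length π →
               ∑ (attach b π τ) (λ σ → ε ^ rank σ * p σ (x ∷ w)) ≡ ε ^ rank τ * p τ w * f
    attached τ lτ = begin
      ε ^ rank (fresh τ ∷ τ) * p (fresh τ ∷ τ) (x ∷ w) + ∑ (map (_∷ τ) (pick b π τ)) (λ σ → ε ^ rank σ * p σ (x ∷ w))
        ≡⟨ cong₂ _+_ (cong₂ (λ r s → ε ^ r * s) (rank-∉ τ (fresh-∉ τ)) (p-∷-∉ τ x w (fresh-∉ τ)))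
                     (∑-map (_∷ τ) (pick b π τ) _) ⟩
      ε ^ rank τ * p τ w + ∑ (pick b π τ) (λ t → ε ^ rank (t ∷ τ) * p (t ∷ τ) (x ∷ w))
        ≡⟨ cong (ε ^ rank τ * p τ w +_) (∑-cong (pick b π τ) λ {t} t∈ →
             cong (λ r → ε ^ r * p (t ∷ τ) (x ∷ w)) (rank-∈ τ (proj₁ (∈-pick⇒∈ b π τ lτ t∈)))) ⟩
      ε ^ rank τ * p τ w + ∑ (pick b π τ) (λ t → ε ^ suc (rank τ) * p (t ∷ τ) (x ∷ w))
        ≡⟨ cong (ε ^ rank τ * p τ w +_) (trans (∑-*ˡ (ε ^ suc (rank τ)) (pick b π τ) _)
             (cong (ε ^ suc (rank τ) *_) (∑-pick b x π τ w lτ (ℕ.suc-injective l) id))) ⟩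
      ε ^ rank τ * p τ w + (ε * ε ^ rank τ) * (p τ w * ℕ→ℚ k)
        ≡⟨ solve 4 (λ e c q n → c :* q :+ (e :* c) :* (q :* n) := c :* q :* (con 1ℚ :+ e :* n)) refl
             ε (ε ^ rank τ) (p τ w) (ℕ→ℚ k) ⟩
      ε ^ rank τ * p τ w * f ∎

-- Different label lists can encode the same set partition, so equal rank is paired with equality of
-- power sums instead of equality of lists.
data Finer (τ π : SetPartition) : Set where
  smaller : rank τ < rank π → Finer τ π
  same    : rank τ ≡ rank π → p τ ≈ p π → Finer τ π

-- Starting a new block although `b` occurs in `π` is the only choice that loses rank; in all other
-- cases the two ranks move together and the power sums stay equal if they were.
forests-finer : ∀ {σ} π → σ ∈ forests π → Finer σ π
forests-finer []      (here refl) = same refl (λ _ → refl)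
forests-finer (b ∷ π) σ∈ with ∈-forests⁻ b π σ∈
... | τ , τ∈ , σ∈′ with ∈-attach⁻ b π τ σ∈′ | forests-finer π τ∈ | b ∈? π
...   | inj₁ refl | smaller lt | yes b∈ =
        smaller (subst₂ _<_ (sym (rank-∉ τ (fresh-∉ τ))) (sym (rank-∈ π b∈)) (ℕ.m<n⇒m<1+n lt))
...   | inj₁ refl | smaller lt | no  b∉ =
        smaller (subst₂ _<_ (sym (rank-∉ τ (fresh-∉ τ))) (sym (rank-∉ π b∉)) lt)
...   | inj₁ refl | same r≡ _  | yes b∈ =
        smaller (subst₂ _<_ (sym (rank-∉ τ (fresh-∉ τ))) (sym (rank-∈ π b∈)) (s≤s (ℕ.≤-reflexive r≡)))
...   | inj₁ refl | same r≡ p≈ | no  b∉ =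
        same (trans (rank-∉ τ (fresh-∉ τ)) (trans r≡ (sym (rank-∉ π b∉)))) λ where
          []      → refl
          (x ∷ w) → trans (p-∷-∉ τ x w (fresh-∉ τ)) (trans (p≈ w) (sym (p-∷-∉ π x w b∉)))
forests-finer (b ∷ π) σ∈ | τ , τ∈ , σ∈′ | inj₂ (t , t∈ , refl) | finer | _
  with lτ ← forests-length π τ∈ with t∈τ , b∈π ← ∈-pick⇒∈ b π τ lτ t∈ | finer
... | smaller lt = smaller (subst₂ _<_ (sym (rank-∈ τ t∈τ)) (sym (rank-∈ π b∈π)) (s≤s lt))
... | same r≡ p≈ = same (trans (rank-∈ τ t∈τ) (trans (cong suc r≡) (sym (rank-∈ π b∈π)))) eq
  where
  eq : p (t ∷ τ) ≈ p (b ∷ π)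
  eq []      = refl
  eq (x ∷ w) with length w ℕ.≟ length π
  ... | no l≢ = trans (p-length (t ∷ τ) (x ∷ w) (λ l → l≢ (trans (ℕ.suc-injective l) lτ)))
                      (sym (p-length (b ∷ π) (x ∷ w) (l≢ ∘ ℕ.suc-injective)))
  ... | yes l≡ with y , ty∈ , by∈ ← ∈-pick⁻ b π τ w lτ l≡ t∈ =
    trans (p-∷-∈ τ x w ty∈) (trans (cong (_* boolℚ (x ≡ᵇ y)) (p≈ w)) (sym (p-∷-∈ π x w by∈)))

∈-forests⁺ : ∀ {σ} b π τ → τ ∈ forests π → σ ∈ attach b π τ → σ ∈ forests (b ∷ π)
∈-forests⁺ b π τ τ∈ σ∈ = ∈-concatMap⁺ (attach b π) (lose τ∈ σ∈)

-- Join whenever a join is possible. This forest makes the coefficient of `p π` nonzero, so that it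
-- can be divided by.
coarsest-forest : ∀ π → ∃[ σ ] σ ∈ forests π × rank σ ≡ rank π
coarsest-forest []      = [] , here refl , refl
coarsest-forest (b ∷ π) with coarsest-forest π | b ∈? π
... | τ , τ∈ , r≡ | no b∉ =
  fresh τ ∷ τ , ∈-forests⁺ b π τ τ∈ (here refl) , trans (rank-∉ τ (fresh-∉ τ)) (trans r≡ (sym (rank-∉ π b∉)))
... | τ , τ∈ , r≡ | yes b∈ with t , t∈ ← pick-nonempty b π τ (forests-length π τ∈) b∈ =
  t ∷ τ , ∈-forests⁺ b π τ τ∈ (there (∈-map⁺ (_∷ τ) t∈)) ,
  trans (rank-∈ τ (proj₁ (∈-pick⇒∈ b π τ (forests-length π τ∈) t∈))) (trans (cong suc r≡) (sym (rank-∈ π b∈)))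

-- Inverting the expansion: power sums as combinations of the `e`

1^ : ∀ n → 1ℚ ^ n ≡ 1ℚ
1^ zero    = refl
1^ (suc n) = trans (ℚ.*-identityˡ (1ℚ ^ n)) (1^ n)

signℚ≡^ : ∀ n → signℚ n ≡ (- 1ℚ) ^ n
signℚ≡^ zero    = refl
signℚ≡^ (suc n) = trans (cong -_ (signℚ≡^ n)) (solve 1 (λ a → :- a := con (- 1ℚ) :* a) refl ((- 1ℚ) ^ n))

signℚ-square : ∀ n → signℚ n * signℚ n ≡ 1ℚ
signℚ-square zero    = refl
signℚ-square (suc n) = trans (solve 1 (λ a → :- a :* :- a := a :* a) refl (signℚ n)) (signℚ-square n)

ℕ→ℚ-inverse : ∀ n → 0 < n → ∃[ c ] c * ℕ→ℚ n ≡ 1ℚ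
ℕ→ℚ-inverse (suc n) _ = (1/ ℕ→ℚ (suc n)) , ℚ.*-inverseˡ (ℕ→ℚ (suc n))
  where instance _ = ℚ.pos⇒nonZero (ℕ→ℚ (suc n)) {{ℚ.normalize-pos (suc n) 1}}

0# : Series
0# _ = 0ℚ

infixl 6 _⊞_
-- A derivation is one finite linear combination evaluated at two families: `F` is its value on `f`
-- and `G` its value on `g`. A linear map taking every `f i` to `g i` then takes `F` to `G`.
data Lin {I : Set} (f g : I → Series) : Series → Series → Set where
  gen   : ∀ i → Lin f g (f i) (g i)
  zero  : Lin f g 0# 0#
  _⊞_   : ∀ {F F′ G G′} → Lin f g F G → Lin f g F′ G′ → Lin f g (F ⊕ F′) (G ⊕ G′)
  scale : ∀ {F G} a → Lin f g F G → Lin f g (a • F) (a • G)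
  respects  : ∀ {F F′ G G′} → F ≈ F′ → G ≈ G′ → Lin f g F G → Lin f g F′ G′

sp : SetPartition → Series
sp π = sgn π • p π

-- An accumulator over the forests of `π`: `n` counts those of full rank, each contributing a copy
-- of `p π` up to sign, while `F` and `G` hold the contributions of smaller rank to `e π` and `h π`.
record Collected (π : SetPartition) (L : List SetPartition) : Set where
  field
    n       : ℕ
    F G     : Series
    lin     : Lin e h F G
    e-sum   : ∀ w → ∑ L (λ τ → (- 1ℚ) ^ rank τ * p τ w) ≡ ℕ→ℚ n * (sgn π * p π w) + F w
    h-sum   : ∀ w → ∑ L (λ τ → 1ℚ ^ rank τ * p τ w) ≡ ℕ→ℚ n * p π w + G w
    nonzero : ∀ {τ} → τ ∈ L → rank τ ≡ rank π → 0 < n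

collect : ∀ π → (∀ τ → rank τ < rank π → Lin e h (p τ) (sp τ)) →
          ∀ L → (∀ {τ} → τ ∈ L → Finer τ π) → Collected π L
collect π ih []      _ = record
  { n = 0 ; lin = zero ; nonzero = λ ()
  ; e-sum = λ w → sym (trans (ℚ.+-identityʳ (0ℚ * (sgn π * p π w))) (ℚ.*-zeroˡ (sgn π * p π w)))
  ; h-sum = λ w → sym (trans (ℚ.+-identityʳ (0ℚ * p π w)) (ℚ.*-zeroˡ (p π w)))
  }
collect π ih (τ ∷ L) finer with collect π ih L (finer ∘ there) | finer (here refl)
... | c | smaller lt = record
  -- Scaled by `sgn τ`, the pair `p τ`, `sp τ` becomes `sgn τ • p τ`, `p τ`, since the sign squares
  -- to 1; these are the terms of `τ` in the expansions of `e π` and `h π`.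
  { n = n ; lin = scale (sgn τ) (ih τ lt) ⊞ lin
  ; nonzero = λ where
      (here refl) r≡ → contradiction lt (ℕ.<-irrefl r≡)
      (there τ∈)  r≡ → nonzero τ∈ r≡
  ; e-sum = λ w → trans (cong₂ _+_ (cong (_* p τ w) (sym (signℚ≡^ (rank τ)))) (e-sum w))
      (solve 3 (λ a b c → a :+ (b :+ c) := b :+ (a :+ c)) refl (sgn τ * p τ w) (ℕ→ℚ n * (sgn π * p π w)) (F w))
  ; h-sum = λ w → trans (cong₂ _+_ (trans (cong (_* p τ w) (trans (1^ (rank τ)) (sym (signℚ-square (rank τ)))))
                                          (ℚ.*-assoc (sgn τ) (sgn τ) (p τ w))) (h-sum w))
      (solve 3 (λ a b c → a :+ (b :+ c) := b :+ (a :+ c)) refl (sgn τ * (sgn τ * p τ w)) (ℕ→ℚ n * p π w) (G w))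
  }
  where open Collected c
... | c | same r≡ p≈ = record
  { n = suc n ; lin = lin ; nonzero = λ _ _ → s≤s z≤n
  ; e-sum = λ w → trans (cong₂ _+_ (cong₂ _*_ (trans (cong ((- 1ℚ) ^_) r≡) (sym (signℚ≡^ (rank π)))) (p≈ w)) (e-sum w))
      (add-one (sgn π * p π w) (F w))
  ; h-sum = λ w → trans (cong₂ _+_ (trans (cong₂ _*_ (1^ (rank τ)) (p≈ w)) (ℚ.*-identityˡ (p π w))) (h-sum w))
      (add-one (p π w) (G w))
  }
  where
  open Collected c
  add-one : ∀ a b → a + (ℕ→ℚ n * a + b) ≡ ℕ→ℚ (suc n) * a + b
  add-one a b = trans (solve 3 (λ n a b → a :+ (n :* a :+ b) := (con 1ℚ :+ n) :* a :+ b) refl (ℕ→ℚ n) a b)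
                      (cong (λ m → m * a + b) (sym (ℕ→ℚ-homo-+ 1 n)))

-- From `e π = n * sgn π * p π + F` and `h π = n * p π + G`: with `c = 1 / n` the combination
-- `c * sgn π * (e π - F)` is `p π`, and its counterpart `c * sgn π * (h π - G)` is `sgn π * p π`.
p-span : ∀ π → Lin e h (p π) (sp π)
p-span π = go π (<-wellFounded (rank π))
  where
  go : ∀ π → Acc _<_ (rank π) → Lin e h (p π) (sp π)
  go π (acc rs) = respects
    (λ w → trans (cong (λ a → c * (s * (a + - 1ℚ * F w))) (trans (e≈E π w) (trans (E-expand (- 1ℚ) π w) (e-sum w))))
      (trans (solve 5 (λ c s n q f → c :* (s :* (n :* (s :* q) :+ f :+ con (- 1ℚ) :* f)) := (c :* n) :* ((s :* s) :* q)) refl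
               c s (ℕ→ℚ n) (p π w) (F w))
        (trans (cong₂ (λ a b → a * (b * p π w)) c-inv (signℚ-square (rank π)))
          (trans (ℚ.*-identityˡ (1ℚ * p π w)) (ℚ.*-identityˡ (p π w))))))
    (λ w → trans (cong (λ a → c * (s * (a + - 1ℚ * G w))) (trans (h≈E π w) (trans (E-expand 1ℚ π w) (h-sum w))))
      (trans (solve 5 (λ c s n q f → c :* (s :* (n :* q :+ f :+ con (- 1ℚ) :* f)) := (c :* n) :* (s :* q)) refl
               c s (ℕ→ℚ n) (p π w) (G w))
        (trans (cong (_* (s * p π w)) c-inv) (ℚ.*-identityˡ (s * p π w)))))
    (scale c (scale s (gen π ⊞ scale (- 1ℚ) lin)))
    where
    open Collected (collect π (λ τ lt → go τ (rs lt)) (forests π) (forests-finer π))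
    s = sgn π
    n>0 : 0 < n
    n>0 with _ , τ∈ , r≡ ← coarsest-forest π = nonzero τ∈ r≡
    c = proj₁ (ℕ→ℚ-inverse n n>0)
    c-inv = proj₂ (ℕ→ℚ-inverse n n>0)

-- Power sums span Π

-- Raises the degree by one; the weight `c x w` ties the new first letter `x` to the rest `w`.
extend : (ℕ → List ℕ → ℚ) → Series → Series
extend c F []      = 0ℚ
extend c F (x ∷ w) = F w * c x w

module _ {I : Set} {f g : I → Series} where

  Lin-∑ : ∀ {J : Set} (js : List J) {F : J → Series} → (∀ j → ∃ (Lin f g (F j))) →
          ∃ (Lin f g λ w → ∑ js λ j → F j w)
  Lin-∑ []       F∈ = 0# , zero
  Lin-∑ (j ∷ js) F∈ = _ , proj₂ (F∈ j) ⊞ proj₂ (Lin-∑ js F∈)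

  Lin-≈ : ∀ {F F′} → F ≈ F′ → ∃ (Lin f g F) → ∃ (Lin f g F′)
  Lin-≈ F≈F′ (G , l) = G , respects F≈F′ (λ _ → refl) l

  Lin-extend : ∀ c → (∀ i → ∃ (Lin f g (extend c (f i)))) →
               ∀ {F G} → Lin f g F G → ∃ (Lin f g (extend c F))
  Lin-extend c gens (gen i) = gens i
  Lin-extend c gens zero = Lin-≈ (λ { [] → refl ; (x ∷ w) → sym (ℚ.*-zeroˡ (c x w)) }) (0# , zero)
  Lin-extend c gens (_⊞_ {F} {F′} l l′) = Lin-≈
    (λ { [] → refl ; (x ∷ w) → sym (ℚ.*-distribʳ-+ (c x w) (F w) (F′ w)) })
    (_ , proj₂ (Lin-extend c gens l) ⊞ proj₂ (Lin-extend c gens l′))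
  Lin-extend c gens (scale {F} a l) = Lin-≈
    (λ { [] → ℚ.*-zeroʳ a ; (x ∷ w) → sym (ℚ.*-assoc a (F w) (c x w)) })
    (_ , scale a (proj₂ (Lin-extend c gens l)))
  Lin-extend c gens (respects F≈F′ _ l) = Lin-≈
    (λ { [] → refl ; (x ∷ w) → cong (_* c x w) (F≈F′ w) })
    (Lin-extend c gens l)

headIs : ℕ → List ℕ → Bool
headIs x []      = false
headIs x (y ∷ _) = x ≡ᵇ y

letter : ℕ → ℕ → List ℕ → ℚ
letter j x w = boolℚ (headIs x (drop j w))

InSpan : Series → Set
InSpan F = ∃ (Lin p sp F)

extend-1-p : ∀ τ → InSpan (extend (λ _ _ → 1ℚ) (p τ))
extend-1-p τ = Lin-≈ (λ { [] → refl ; (x ∷ w) → trans (p-∷-∉ τ x w (fresh-∉ τ)) (sym (ℚ.*-identityʳ (p τ w))) })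
                     (_ , gen (fresh τ ∷ τ))

drop-zip : ∀ {t} j (τ w : List ℕ) {τ′} → length w ≡ length τ → drop j τ ≡ t ∷ τ′ →
           ∃₂ λ y w′ → drop j w ≡ y ∷ w′ × (t , y) ∈ zip τ w
drop-zip zero    (t ∷ τ) (y ∷ w) l refl = y , w , refl , here refl
drop-zip (suc j) (_ ∷ τ) (_ ∷ w) l eq   =
  let y , w′ , eq′ , ty∈ = drop-zip j τ w (ℕ.suc-injective l) eq in y , w′ , eq′ , there ty∈
drop-zip zero    [] _ _ ()
drop-zip (suc j) [] _ _ ()

drop-[] : ∀ j (τ w : List ℕ) → length w ≡ length τ → drop j τ ≡ [] → drop j w ≡ []
drop-[] zero    []      []      l eq = refl
drop-[] (suc j) []      []      l eq = refl
drop-[] (suc j) (_ ∷ τ) (_ ∷ w) l eq = drop-[] j τ w (ℕ.suc-injective l) eq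

-- Asking the new letter to repeat the one at position `j` puts it into the block of that position.
-- If `τ` has no such position, neither has any word on which `p τ` lives, and the series is 0.
extend-letter-p : ∀ j τ → InSpan (extend (letter j) (p τ))
extend-letter-p j τ with drop j τ in eq
... | []     = Lin-≈ (λ { [] → refl ; (x ∷ w) → sym (vanish x w) }) (_ , zero)
  where
  vanish : ∀ x w → p τ w * letter j x w ≡ 0ℚ
  vanish x w with length w ℕ.≟ length τ
  ... | yes l = trans (cong (λ v → p τ w * boolℚ (headIs x v)) (drop-[] j τ w l eq)) (ℚ.*-zeroʳ (p τ w))
  ... | no l≢ = trans (cong (_* letter j x w) (p-length τ w l≢)) (ℚ.*-zeroˡ (letter j x w))
... | t ∷ τ′ = Lin-≈ (λ { [] → refl ; (x ∷ w) → join x w }) (_ , gen (t ∷ τ))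
  where
  join : ∀ x w → p (t ∷ τ) (x ∷ w) ≡ p τ w * letter j x w
  join x w with length w ℕ.≟ length τ
  ... | no l≢ = trans (p-length (t ∷ τ) (x ∷ w) (l≢ ∘ ℕ.suc-injective))
                  (sym (trans (cong (_* letter j x w) (p-length τ w l≢)) (ℚ.*-zeroˡ (letter j x w))))
  ... | yes l with y , w′ , eq′ , ty∈ ← drop-zip j τ w l eq =
    trans (p-∷-∈ τ x w ty∈) (cong (λ v → p τ w * boolℚ (headIs x v)) (sym eq′))

transpose : ℕ → ℕ → ℕ → ℕ
transpose a b n = if n ≡ᵇ a then b else if n ≡ᵇ b then a else n

transpose-source : ∀ a b → transpose a b a ≡ b
transpose-source a b rewrite ≡ᵇ-refl a = refl

transpose-other : ∀ {a b n} → n ≢ a → n ≢ b → transpose a b n ≡ n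
transpose-other n≢a n≢b rewrite ≢⇒≡ᵇ-false n≢a | ≢⇒≡ᵇ-false n≢b = refl

transpose-target : ∀ a b → transpose a b b ≡ a
transpose-target a b with b ≡ᵇ a | ≡ᵇ-reflects b a
... | true  | ofʸ b≡a = b≡a
... | false | _ rewrite ≡ᵇ-refl b = refl

transpose-involutive : ∀ a b n → transpose a b (transpose a b n) ≡ n
transpose-involutive a b n with n ≡ᵇ a | ≡ᵇ-reflects n a
... | true  | ofʸ refl = transpose-target n b
... | false | ofⁿ n≢a with n ≡ᵇ b | ≡ᵇ-reflects n b
...   | true  | ofʸ refl = transpose-source a n
...   | false | ofⁿ n≢b  = transpose-other n≢a n≢b

transposition : ℕ → ℕ → ℕ ↔ ℕ
transposition a b = mk↔ₛ′ (transpose a b) (transpose a b) (transpose-involutive a b) (transpose-involutive a b)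

↔-injective : ∀ (σ : ℕ ↔ ℕ) {x y} → Inverse.to σ x ≡ Inverse.to σ y → x ≡ y
↔-injective σ {x} {y} eq = trans (sym (Inverse.strictlyInverseʳ σ x)) (trans (cong (Inverse.from σ) eq) (Inverse.strictlyInverseʳ σ y))

∉-map : ∀ (σ : ℕ ↔ ℕ) {x} w → x ∉ w → Inverse.to σ x ∉ map (Inverse.to σ) w
∉-map σ w x∉ σx∈ with y , y∈ , eq ← ∈-map⁻ (Inverse.to σ) σx∈ = x∉ (subst (_∈ w) (sym (↔-injective σ eq)) y∈)

module _ {F : Series} (F-sym : VarSymmetric F) where

  -- The transposition of `a` and `b` fixes every letter of `u`.
  new-letter : ∀ {a b} u → a ∉ u → b ∉ u → F (a ∷ u) ≡ F (b ∷ u)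
  new-letter {a} {b} u a∉ b∉ = sym (begin
    F (b ∷ u)                    ≡⟨ cong F (sym (cong₂ _∷_ (transpose-source a b) (fixed u a∉ b∉))) ⟩
    F (map (transpose a b) (a ∷ u)) ≡⟨ F-sym (transposition a b) (a ∷ u) ⟩
    F (a ∷ u)                    ∎)
    where
    open ≡-Reasoning
    fixed : ∀ u → a ∉ u → b ∉ u → map (transpose a b) u ≡ u
    fixed []      _  _  = refl
    fixed (x ∷ u) a∉ b∉ = cong₂ _∷_ (transpose-other (a∉ ∘ here ∘ sym) (b∉ ∘ here ∘ sym))
                                    (fixed u (a∉ ∘ there) (b∉ ∘ there))

  generic : Series
  generic w = F (fresh w ∷ w)

  generic-sym : VarSymmetric generic
  generic-sym σ w = trans
    (new-letter (map to w) (fresh-∉ (map to w)) (∉-map σ w (fresh-∉ w)))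
    (F-sym σ (fresh w ∷ w))
    where open Inverse σ using (to)

  -- A letter occurring several times in v is accounted for at its last occurrence only.
  excess : List ℕ → List ℕ → ℚ
  excess w []      = 0ℚ
  excess w (y ∷ v) = if does (y ∈? v) then 0ℚ else F (y ∷ w) + - generic w

  excess-sym : ∀ σ w v → excess (map (Inverse.to σ) w) (map (Inverse.to σ) v) ≡ excess w v
  excess-sym σ w []      = refl
  excess-sym σ w (y ∷ v) with Inverse.to σ y ∈? map (Inverse.to σ) v | y ∈? v
  ... | yes _  | yes _ = refl
  ... | yes σy∈ | no y∉ = contradiction σy∈ (∉-map σ v y∉)
  ... | no σy∉ | yes y∈ = contradiction (∈-map⁺ (Inverse.to σ) y∈) σy∉
  ... | no _   | no _  = cong₂ (λ a b → a + - b) (F-sym σ (y ∷ w)) (generic-sym σ w)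

  repeated : ℕ → Series
  repeated j w = excess w (drop j w)

  repeated-sym : ∀ j → VarSymmetric (repeated j)
  repeated-sym j σ w = trans (cong (excess (map to w)) (drop-map j w)) (excess-sym σ w (drop j w))
    where open Inverse σ using (to)

  excess-∉ : ∀ x w v → x ∉ v →
             sumℚ (applyUpTo (λ j → excess w (drop j v) * letter j x v) (length v)) ≡ 0ℚ
  excess-∉ x w []      x∉ = refl
  excess-∉ x w (y ∷ v) x∉ rewrite ≢⇒≡ᵇ-false (x∉ ∘ here) =
    trans (cong₂ _+_ (ℚ.*-zeroʳ (excess w (y ∷ v))) (excess-∉ x w v (x∉ ∘ there))) refl

  excess-∈ : ∀ x w v → x ∈ v →
             sumℚ (applyUpTo (λ j → excess w (drop j v) * letter j x v) (length v)) ≡ F (x ∷ w) + - generic w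
  excess-∈ x w (y ∷ v) x∈ with x ≡ᵇ y | ≡ᵇ-reflects x y | y ∈? v | x∈
  ... | true  | ofʸ refl | yes y∈ | _ = trans (ℚ.+-identityˡ _) (excess-∈ x w v y∈)
  ... | true  | ofʸ refl | no  y∉ | _ =
    trans (cong₂ _+_ (ℚ.*-identityʳ (F (x ∷ w) + - generic w)) (excess-∉ x w v y∉))
          (ℚ.+-identityʳ (F (x ∷ w) + - generic w))
  ... | false | ofⁿ x≢y  | _ | here x≡y = contradiction x≡y x≢y
  ... | false | _ | yes _ | there x∈v = trans (ℚ.+-identityˡ _) (excess-∈ x w v x∈v)
  ... | false | _ | no  _ | there x∈v =
    trans (cong₂ _+_ (ℚ.*-zeroʳ (F (y ∷ w) + - generic w)) (excess-∈ x w v x∈v))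
          (ℚ.+-identityˡ (F (x ∷ w) + - generic w))

  -- `generic w` is already right for letters outside `w`. For `x` in `w` the sum supplies the
  -- difference, in the single term where `j` is the last occurrence of `x`. Indexing by positions
  -- instead of letters keeps each `repeated j` invariant under renaming, so that an induction can
  -- apply to it.
  F-∷ : ∀ x w → F (x ∷ w) ≡ generic w + ∑ (upTo (length w)) (λ j → repeated j w * letter j x w)
  F-∷ x w = trans split (cong (λ l → generic w + sumℚ l) (sym (map-upTo (λ j → repeated j w * letter j x w) (length w))))
    where
    split : F (x ∷ w) ≡ generic w + sumℚ (applyUpTo (λ j → repeated j w * letter j x w) (length w))
    split with x ∈? w
    ... | yes x∈ = trans (solve 2 (λ a b → a := b :+ (a :+ :- b)) refl (F (x ∷ w)) (generic w))
                         (cong (generic w +_) (sym (excess-∈ x w w x∈)))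
    ... | no x∉  = trans (new-letter w x∉ (fresh-∉ w))
                     (trans (sym (ℚ.+-identityʳ (generic w))) (cong (generic w +_) (sym (excess-∉ x w w x∉))))

homogeneous : ℕ → Series → Series
homogeneous n F w = if length w ≡ᵇ n then F w else 0ℚ

-- `F-∷` presents degree `suc n` through the degree `n` parts of `generic` and `repeated j`, which
-- are symmetric again. On each `p τ` of their expansions, the new letter opens a block or joins the
-- one at position `j`.
homogeneous-span : ∀ n {F} → VarSymmetric F → InSpan (homogeneous n F)
homogeneous-span zero {F} F-sym = Lin-≈
  (λ { [] → ℚ.*-identityʳ (F []) ; (x ∷ w) → ℚ.*-zeroʳ (F []) })
  (_ , scale (F []) (gen []))
homogeneous-span (suc n) {F} F-sym = Lin-≈ eq
  (_ , proj₂ (Lin-extend (λ _ _ → 1ℚ) extend-1-p (proj₂ (homogeneous-span n (generic-sym F-sym))))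
     ⊞ proj₂ (Lin-∑ (upTo n) (λ j → Lin-extend (letter j) (extend-letter-p j)
                                       (proj₂ (homogeneous-span n (repeated-sym F-sym j))))))
  where
  eq : extend (λ _ _ → 1ℚ) (homogeneous n (generic F-sym))
         ⊕ (λ w → ∑ (upTo n) (λ j → extend (letter j) (homogeneous n (repeated F-sym j)) w))
       ≈ homogeneous (suc n) F
  eq []      = trans (ℚ.+-identityˡ _) (∑-zero (upTo n) (λ _ → refl))
  eq (x ∷ w) with length w ≡ᵇ n | ≡ᵇ-reflects (length w) n
  ... | true  | ofʸ refl = trans (cong (_+ ∑ (upTo (length w)) (λ j → repeated F-sym j w * letter j x w)) (ℚ.*-identityʳ (generic F-sym w))) (sym (F-∷ F-sym x w))
  ... | false | _ = trans (ℚ.+-identityˡ _) (∑-zero (upTo n) (λ {j} _ → ℚ.*-zeroˡ (letter j x w)))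

∑-indicator : ∀ l m a → l < m → sumℚ (applyUpTo (λ n → if l ≡ᵇ n then a else 0ℚ) m) ≡ a
∑-indicator zero    (suc m) a l<m = trans (cong (a +_) (zeros m {id})) (ℚ.+-identityʳ a)
  where
  zeros : ∀ m {f : ℕ → ℕ} → sumℚ (applyUpTo (λ n → if 0 ≡ᵇ suc (f n) then a else 0ℚ) m) ≡ 0ℚ
  zeros zero        = refl
  zeros (suc m) {f} = trans (ℚ.+-identityˡ _) (zeros m {f ∘ suc})
∑-indicator (suc l) (suc m) a (s≤s l<m) = trans (ℚ.+-identityˡ _) (∑-indicator l m a l<m)

-- A degree bound `d` leaves only the `suc d` homogeneous components of degrees 0 to `d`.
Π-span : ∀ F → InΠ F → InSpan F
Π-span F ((d , F-bounded) , F-sym) = Lin-≈ eq (Lin-∑ (upTo (suc d)) (λ n → homogeneous-span n F-sym))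
  where
  eq : (λ w → ∑ (upTo (suc d)) (λ n → homogeneous n F w)) ≈ F
  eq w with length w ℕ.≤? d
  ... | yes l≤d = trans (cong sumℚ (map-upTo (λ n → homogeneous n F w) (suc d))) (∑-indicator (length w) (suc d) (F w) (s≤s l≤d))
  ... | no  l≰d with F0 ← F-bounded w (ℕ.≰⇒> l≰d) = trans (∑-zero (upTo (suc d)) (λ {n} _ → vanish n)) (sym F0)
    where
    vanish : ∀ n → homogeneous n F w ≡ 0ℚ
    vanish n with length w ≡ᵇ n
    ... | true  = F0
    ... | false = refl

-- Closure properties of Π and the action of ω on it

InΠ-⊕ : ∀ {F G} → InΠ F → InΠ G → InΠ (F ⊕ G)
InΠ-⊕ ((d , F0) , F-sym) ((d′ , G0) , G-sym) =
  (d ℕ.⊔ d′ , λ w lt → cong₂ _+_ (F0 w (ℕ.≤-<-trans (ℕ.m≤m⊔n d d′) lt)) (G0 w (ℕ.≤-<-trans (ℕ.m≤n⊔m d d′) lt))) ,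
  λ σ w → cong₂ _+_ (F-sym σ w) (G-sym σ w)

InΠ-• : ∀ {F} a → InΠ F → InΠ (a • F)
InΠ-• a ((d , F0) , F-sym) =
  (d , λ w lt → trans (cong (a *_) (F0 w lt)) (ℚ.*-zeroʳ a)) , λ σ w → cong (a *_) (F-sym σ w)

InΠ-≈ : ∀ {F G} → F ≈ G → InΠ F → InΠ G
InΠ-≈ F≈G ((d , F0) , F-sym) =
  (d , λ w lt → trans (sym (F≈G w)) (F0 w lt)) , λ σ w → trans (sym (F≈G _)) (trans (F-sym σ w) (F≈G w))

InΠ-0 : InΠ 0#
InΠ-0 = (0 , λ _ _ → refl) , λ _ _ → refl

InΠ-∑ : ∀ {J : Set} (js : List J) {F : J → Series} → (∀ j → InΠ (F j)) → InΠ (λ w → ∑ js (λ j → F j w))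
InΠ-∑ []       F∈ = InΠ-0
InΠ-∑ (j ∷ js) F∈ = InΠ-⊕ (F∈ j) (InΠ-∑ js F∈)

≡ᵇ-↔ : ∀ (σ : ℕ ↔ ℕ) x y → (Inverse.to σ x ≡ᵇ Inverse.to σ y) ≡ (x ≡ᵇ y)
≡ᵇ-↔ σ x y with x ≡ᵇ y | ≡ᵇ-reflects x y
... | true  | ofʸ refl = ≡ᵇ-refl (Inverse.to σ x)
... | false | ofⁿ x≢y  = ≢⇒≡ᵇ-false (x≢y ∘ ↔-injective σ)

p-sym : ∀ π → VarSymmetric (p π)
p-sym []      σ []      = refl
p-sym []      σ (_ ∷ _) = refl
p-sym (_ ∷ _) σ []      = refl
p-sym (b ∷ π) σ (x ∷ w) = begin
  p (b ∷ π) (map to (x ∷ w))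
    ≡⟨ p-∷ b π (to x) (map to w) ⟩
  p π (map to w) * boolℚ (allᵇ (pCoeffOK (b , to x)) (zip π (map to w)))
    ≡⟨ cong₂ (λ q a → q * boolℚ a) (p-sym π σ w) (invariant π w) ⟩
  p π w * boolℚ (allᵇ (pCoeffOK (b , x)) (zip π w))
    ≡⟨ sym (p-∷ b π x w) ⟩
  p (b ∷ π) (x ∷ w) ∎
  where
  open ≡-Reasoning
  open Inverse σ using (to)
  invariant : ∀ π w → allᵇ (pCoeffOK (b , to x)) (zip π (map to w)) ≡ allᵇ (pCoeffOK (b , x)) (zip π w)
  invariant []      w       = refl
  invariant (_ ∷ _) []      = refl
  invariant (c ∷ π) (y ∷ w) = cong₂ (λ s t → (not (b ≡ᵇ c) ∨ s) ∧ t) (≡ᵇ-↔ σ x y) (invariant π w)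

InΠ-p : ∀ π → InΠ (p π)
InΠ-p π = (length π , λ w lt → p-length π w (ℕ.>⇒≢ lt)) , p-sym π

InΠ-E : ∀ ε π → InΠ (E ε π)
InΠ-E ε π = InΠ-≈ (λ w → sym (E-expand ε π w)) (InΠ-∑ (forests π) (λ τ → InΠ-• (ε ^ rank τ) (InΠ-p τ)))

InΠ-e : ∀ π → InΠ (e π)
InΠ-e π = InΠ-≈ (sym ∘ e≈E π) (InΠ-E (- 1ℚ) π)

InΠ-Lin : ∀ {F G} → Lin e h F G → InΠ F
InΠ-Lin (gen π)              = InΠ-e π
InΠ-Lin zero                 = InΠ-0
InΠ-Lin (l ⊞ l′)             = InΠ-⊕ (InΠ-Lin l) (InΠ-Lin l′)
InΠ-Lin (scale a l)          = InΠ-• a (InΠ-Lin l)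
InΠ-Lin (respects F≈F′ _ l)  = InΠ-≈ F≈F′ (InΠ-Lin l)

substitute : ∀ {I J} {f g : I → Series} {f′ g′ : J → Series} → (∀ i → Lin f′ g′ (f i) (g i)) →
             ∀ {F G} → Lin f g F G → Lin f′ g′ F G
substitute gens (gen i)              = gens i
substitute gens zero                 = zero
substitute gens (l ⊞ l′)             = substitute gens l ⊞ substitute gens l′
substitute gens (scale a l)          = scale a (substitute gens l)
substitute gens (respects F≈ G≈ l)   = respects F≈ G≈ (substitute gens l)

Lin-sym : ∀ {I} {f g : I → Series} {F G} → Lin f g F G → Lin g f G F
Lin-sym (gen i)            = gen i
Lin-sym zero               = zero
Lin-sym (l ⊞ l′)           = Lin-sym l ⊞ Lin-sym l′
Lin-sym (scale a l)        = scale a (Lin-sym l)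
Lin-sym (respects F≈ G≈ l) = respects G≈ F≈ (Lin-sym l)

-- Scaling by `sgn π` turns the pair `p π`, `sp π` into `sp π`, `p π`. The symmetry holds for these
-- generators and hence for all combinations of them.
Lin-swap : ∀ {F G} → Lin p sp F G → Lin p sp G F
Lin-swap l = substitute swap-p (Lin-sym l)
  where
  swap-p : ∀ π → Lin p sp (sp π) (p π)
  swap-p π = respects (λ _ → refl)
    (λ w → trans (sym (ℚ.*-assoc (sgn π) (sgn π) (p π w)))
             (trans (cong (_* p π w) (signℚ-square (rank π))) (ℚ.*-identityˡ (p π w))))
    (scale (sgn π) (gen π))

-- `to` will show that ω takes `F` to `image`, and `back` that it takes `image` to `F`.
record Expansion (F : Series) : Set where
  field
    image : Series
    to    : Lin e h F image
    back  : Lin e h image F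

decompose : ∀ F → InΠ F → Expansion F
decompose F F∈ with G , l ← Π-span F F∈ = record
  { image = G ; to = substitute p-span l ; back = substitute p-span (Lin-swap l) }

module Omega {ω : Series → Series} (ω-linear : IsLinearOn InΠ ω) (ω-e : ∀ π → ω (e π) ≈ h π) where

  private
    preserves = proj₁ ω-linear
    congruent = proj₁ (proj₂ ω-linear)
    additive  = proj₁ (proj₂ (proj₂ ω-linear))
    homogen   = proj₂ (proj₂ (proj₂ ω-linear))

  -- Linearity has no separate clause for zero, so `0#` enters as `0ℚ • 0#`.
  ω-0 : ω 0# ≈ 0#
  ω-0 w = trans (congruent 0# (0ℚ • 0#) InΠ-0 (InΠ-• 0ℚ InΠ-0) (λ _ → refl) w)
            (trans (homogen 0ℚ 0# InΠ-0 w) (ℚ.*-zeroˡ (ω 0# w)))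

  ω-Lin : ∀ {F G} → Lin e h F G → ω F ≈ G
  ω-Lin (gen π) = ω-e π
  ω-Lin zero    = ω-0
  ω-Lin (_⊞_ {F} {F′} l l′) w =
    trans (additive F F′ (InΠ-Lin l) (InΠ-Lin l′) w) (cong₂ _+_ (ω-Lin l w) (ω-Lin l′ w))
  ω-Lin (scale {F} a l) w = trans (homogen a F (InΠ-Lin l) w) (cong (a *_) (ω-Lin l w))
  ω-Lin (respects {F} {F′} F≈F′ G≈G′ l) w =
    trans (congruent F′ F (InΠ-≈ F≈F′ (InΠ-Lin l)) (InΠ-Lin l) (sym ∘ F≈F′) w) (trans (ω-Lin l w) (G≈G′ w))

  ω-involutive : ∀ F → InΠ F → ω (ω F) ≈ F
  ω-involutive F F∈ w =
    trans (congruent (ω F) image (preserves F F∈) (InΠ-Lin back) (ω-Lin to) w) (ω-Lin back w)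
    where open Expansion (decompose F F∈)

  ω-p : ∀ π → ω (p π) ≈ sgn π • p π
  ω-p π = ω-Lin (p-span π)

-- The projection ρ

infix 4 _≋_
_≋_ : List ℕ → List ℕ → Set
u ≋ w = ∀ x → countᵇ x u ≡ countᵇ x w

count-here : ∀ x w → countᵇ x (x ∷ w) ≡ suc (countᵇ x w)
count-here x w rewrite ≡ᵇ-refl x = refl

count-there : ∀ {x y} w → x ≢ y → countᵇ x (y ∷ w) ≡ countᵇ x w
count-there w x≢y rewrite ≢⇒≡ᵇ-false x≢y = refl

count-∉ : ∀ {x} w → x ∉ w → countᵇ x w ≡ 0
count-∉ []      x∉ = refl
count-∉ (y ∷ w) x∉ = trans (count-there w (x∉ ∘ here)) (count-∉ w (x∉ ∘ there))

0<count⇒∈ : ∀ {x} w → 0 < countᵇ x w → x ∈ w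
0<count⇒∈ {x} w 0< with x ∈? w
... | yes x∈ = x∈
... | no  x∉ = contradiction (sym (count-∉ w x∉)) (ℕ.<⇒≢ 0<)

∈⇒0<count : ∀ {x} w → x ∈ w → 0 < countᵇ x w
∈⇒0<count {x} (y ∷ w) x∈ with x ≡ᵇ y | ≡ᵇ-reflects x y | x∈
... | true  | _       | _         = s≤s z≤n
... | false | ofⁿ x≢y | here x≡y  = contradiction x≡y x≢y
... | false | _       | there x∈w = ∈⇒0<count w x∈w

count-++ : ∀ x u v → countᵇ x (u ++ v) ≡ countᵇ x u ℕ.+ countᵇ x v
count-++ x []      v = refl
count-++ x (y ∷ u) v with x ≡ᵇ y
... | true  = cong suc (count-++ x u v)
... | false = count-++ x u v

count-∷-cong : ∀ x y {u w} → countᵇ x u ≡ countᵇ x w → countᵇ x (y ∷ u) ≡ countᵇ x (y ∷ w)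
count-∷-cong x y eq with x ≡ᵇ y
... | true  = cong suc eq
... | false = eq

count-∷-injective : ∀ x y {u w} → countᵇ x (y ∷ u) ≡ countᵇ x (y ∷ w) → countᵇ x u ≡ countᵇ x w
count-∷-injective x y eq with x ≡ᵇ y
... | true  = ℕ.suc-injective eq
... | false = eq

↭⇒≋ : ∀ {u w} → u ↭ w → u ≋ w
↭⇒≋ _↭_.refl          x = refl
↭⇒≋ {_ ∷ u} {_ ∷ w} (prep y u↭w) x = count-∷-cong x y {u} {w} (↭⇒≋ u↭w x)
↭⇒≋ (swap y z u↭w)    x with x ≡ᵇ y | x ≡ᵇ z
... | true  | true  = cong (suc ∘ suc) (↭⇒≋ u↭w x)
... | true  | false = cong suc (↭⇒≋ u↭w x)
... | false | true  = cong suc (↭⇒≋ u↭w x)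
... | false | false = ↭⇒≋ u↭w x
↭⇒≋ (_↭_.trans p q)   x = trans (↭⇒≋ p x) (↭⇒≋ q x)

≋⇒↭ : ∀ u w → u ≋ w → u ↭ w
≋⇒↭ []      []      eq = ↭-refl
≋⇒↭ []      (y ∷ w) eq = contradiction (trans (eq y) (count-here y w)) λ ()
≋⇒↭ (x ∷ u) w       eq
  with w₁ , w₂ , refl ← ∈-∃++ (0<count⇒∈ w (subst (0 <_) (trans (sym (count-here x u)) (eq x)) (s≤s z≤n))) =
  ↭-trans (prep x (≋⇒↭ u (w₁ ++ w₂) λ y → count-∷-injective y x {u} {w₁ ++ w₂} (trans (eq y) (↭⇒≋ (shift x w₁ w₂) y))))
          (↭-sym (shift x w₁ w₂))

∈-words⁺ : ∀ {A} v → All (_∈ A) v → v ∈ words (length v) A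
∈-words⁺ []          []          = here refl
∈-words⁺ {A} (x ∷ v) (x∈ ∷ v⊆)   =
  ∈-concatMap⁺ (λ a → map (a ∷_) (words (length v) A)) (lose x∈ (∈-map⁺ (x ∷_) (∈-words⁺ v v⊆)))

unique-concatMap : ∀ {A B : Set} (f : A → List B) xs → All (Unique ∘ f) xs →
                   AllPairs (λ x y → ∀ z → z ∈ f x → z ∈ f y → x ≡ y) xs → Unique xs → Unique (concatMap f xs)
unique-concatMap f xs fs! disjoint xs! = Unique.concat⁺ (All.map⁺ fs!)
  (AllPairs.map⁺ (AllPairs.zipWith (λ { (d , x≢y) (z∈x , z∈y) → x≢y (d _ z∈x z∈y) }) (disjoint , xs!)))

words-! : ∀ n {A} → Unique A → Unique (words n A)
words-! zero    A! = [] ∷ []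
words-! (suc n) {A} A! = unique-concatMap _ A (All.tabulate λ _ → Unique.map⁺ (λ { refl → refl }) (words-! n A!))
  (AllPairs.map (λ _ → same-head) A!) A!
  where
  same-head : ∀ {x y} z → z ∈ map (x ∷_) (words n A) → z ∈ map (y ∷_) (words n A) → x ≡ y
  same-head _ z∈x z∈y with _ , _ , refl ← ∈-map⁻ _ z∈x | _ , _ , refl ← ∈-map⁻ _ z∈y = refl

T⇒≡true : ∀ {b} → T b → b ≡ true
T⇒≡true = Equivalence.to T-≡

∈-rearrangements⁺ : ∀ {v w} → v ↭ w → v ∈ rearrangements w
∈-rearrangements⁺ {v} {w} v↭w = ∈-filter⁺ (λ u → T? (sameMultiset u w))
  (subst (λ n → v ∈ words n (distinct w)) (↭-length v↭w)
    (∈-words⁺ v (All.tabulate (Distinct.∈-dedup⁺ w ∘ ∈-resp-↭ v↭w))))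
  (Equivalence.from T-≡ (cong₂ _∧_ (T⇒≡true (≡⇒≡ᵇ (length v) (length w) (↭-length v↭w)))
    (allᵇ⁺ (v ++ w) λ {x} _ → T⇒≡true (≡⇒≡ᵇ _ _ (↭⇒≋ v↭w x)))))

∈-rearrangements⁻ : ∀ {v} w → v ∈ rearrangements w → v ↭ w
∈-rearrangements⁻ {v} w v∈ = ≋⇒↭ v w counts
  where
  letters : allᵇ (λ x → countᵇ x v ≡ᵇ countᵇ x w) (v ++ w) ≡ true
  letters with true ← length v ≡ᵇ length w
             | t ← proj₂ (∈-filter⁻ (λ u → T? (sameMultiset u w)) {xs = words (length w) (distinct w)} v∈)
    = T⇒≡true t
  counts : v ≋ w
  counts x with x ∈? (v ++ w)
  ... | yes x∈ = ≡ᵇ⇒≡ _ _ (Equivalence.from T-≡ (allᵇ⁻ letters x∈))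
  ... | no  x∉ = trans (count-∉ v (x∉ ∘ ∈-++⁺ˡ)) (sym (count-∉ w (x∉ ∘ ∈-++⁺ʳ v)))

rearrangements-! : ∀ w → Unique (rearrangements w)
rearrangements-! w = Unique.filter⁺ _ (words-! (length w) (Distinct.dedup-! w))

rearrangements-cong : ∀ {u w} → u ↭ w → rearrangements u ↭ rearrangements w
rearrangements-cong {u} {w} u↭w = unique⇒↭ (rearrangements-! u) (rearrangements-! w)
  (λ v∈ → ∈-rearrangements⁺ (↭-trans (∈-rearrangements⁻ u v∈) u↭w))
  (λ v∈ → ∈-rearrangements⁺ (↭-trans (∈-rearrangements⁻ w v∈) (↭-sym u↭w)))

rearrangements-map : ∀ (σ : ℕ ↔ ℕ) w → rearrangements (map (Inverse.to σ) w) ↭ map (map (Inverse.to σ)) (rearrangements w)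
rearrangements-map σ w = unique⇒↭ (rearrangements-! (map to w))
  (Unique.map⁺ (map-injective (↔-injective σ)) (rearrangements-! w)) ⊆ ⊇
  where
  open Inverse σ using (to; from; strictlyInverseˡ; strictlyInverseʳ)
  to-from : ∀ v → map to (map from v) ≡ v
  to-from v = trans (sym (map-∘ v)) (trans (map-cong strictlyInverseˡ v) (map-id v))
  from-to : ∀ v → map from (map to v) ≡ v
  from-to v = trans (sym (map-∘ v)) (trans (map-cong strictlyInverseʳ v) (map-id v))
  ⊆ : ∀ {v} → v ∈ rearrangements (map to w) → v ∈ map (map to) (rearrangements w)
  ⊆ {v} v∈ = subst (_∈ _) (to-from v) (∈-map⁺ (map to) (∈-rearrangements⁺
    (↭-trans (map⁺ from (∈-rearrangements⁻ (map to w) v∈)) (↭-reflexive (from-to w)))))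
  ⊇ : ∀ {v} → v ∈ map (map to) (rearrangements w) → v ∈ rearrangements (map to w)
  ⊇ v∈ with u , u∈ , refl ← ∈-map⁻ (map to) v∈ = ∈-rearrangements⁺ (map⁺ to (∈-rearrangements⁻ w u∈))

ρ-vanish : ∀ F w → (∀ {v} → v ↭ w → F v ≡ 0ℚ) → ρ F w ≡ 0ℚ
ρ-vanish F w F0 = ∑-zero (rearrangements w) (F0 ∘ ∈-rearrangements⁻ w)

InΛ-ρ : ∀ {F} → InΠ F → InΛ (ρ F)
InΛ-ρ {F} ((d , F0) , F-sym) =
  (λ u w u↭w → ∑-↭ F (rearrangements-cong u↭w)) ,
  (d , λ w lt → ρ-vanish F w λ v↭w → F0 _ (subst (d <_) (sym (↭-length v↭w)) lt)) ,
  λ σ w → trans (∑-↭ F (rearrangements-map σ w))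
    (trans (∑-map (map (Inverse.to σ)) (rearrangements w) F) (∑-cong (rearrangements w) λ {v} _ → F-sym σ v))

ρ-cong : ∀ {F G} → F ≈ G → ρ F ≈ ρ G
ρ-cong F≈G w = ∑-cong (rearrangements w) (λ {v} _ → F≈G v)

ρ-⊕ : ∀ F G → ρ (F ⊕ G) ≈ ρ F ⊕ ρ G
ρ-⊕ F G w = ∑-distrib-+ (rearrangements w) F G

ρ-• : ∀ a F → ρ (a • F) ≈ a • ρ F
ρ-• a F w = ∑-*ˡ a (rearrangements w) F

ρ-0 : ρ 0# ≈ 0#
ρ-0 w = ∑-zero (rearrangements w) (λ _ → refl)

-- `ρ` on a single block

stack : ℚ → Series
stack ε []      = 1ℚ
stack ε (x ∷ w) = stack ε w * factor ε (countᵇ x w)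

-- This is `E ε` for one block of size `k`: all labels agree, so only letters are counted.
block : ℚ → ℕ → Series
block ε k w = if length w ≡ᵇ k then stack ε w else 0ℚ

delete : ℕ → List ℕ → List ℕ
delete x []      = []
delete x (y ∷ w) = if x ≡ᵇ y then w else y ∷ delete x w

delete-↭ : ∀ {x} w → x ∈ w → w ↭ x ∷ delete x w
delete-↭ {x} (y ∷ w) x∈ with x ≡ᵇ y | ≡ᵇ-reflects x y | x∈
... | true  | ofʸ refl | _         = ↭-refl
... | false | ofⁿ x≢y  | here x≡y  = contradiction x≡y x≢y
... | false | _        | there x∈w = ↭-trans (prep y (delete-↭ w x∈w)) (swap y x ↭-refl)

-- Sorts the rearrangements by first letter. The empty word has a rearrangement but no first letter,
-- hence the condition on the length.
rearrangements-∷ : ∀ w n → length w ≡ suc n →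
  rearrangements w ↭ concatMap (λ x → map (x ∷_) (rearrangements (delete x w))) (distinct w)
rearrangements-∷ w n l = unique⇒↭ (rearrangements-! w)
  (unique-concatMap f (distinct w)
    (All.tabulate λ {x} _ → Unique.map⁺ (λ { refl → refl }) (rearrangements-! (delete x w)))
    (AllPairs.map (λ _ → same-head) (Distinct.dedup-! w)) (Distinct.dedup-! w))
  (⊆ _) ⊇
  where
  f : ℕ → List (List ℕ)
  f x = map (x ∷_) (rearrangements (delete x w))
  same-head : ∀ {x y} z → z ∈ f x → z ∈ f y → x ≡ y
  same-head _ z∈x z∈y with _ , _ , refl ← ∈-map⁻ _ z∈x | _ , _ , refl ← ∈-map⁻ _ z∈y = refl
  ⊆ : ∀ v → v ∈ rearrangements w → v ∈ concatMap f (distinct w)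
  ⊆ []      v∈ = contradiction (trans (↭-length (∈-rearrangements⁻ w v∈)) l) λ ()
  ⊆ (x ∷ v) v∈ = ∈-concatMap⁺ f (lose (Distinct.∈-dedup⁺ w x∈)
      (∈-map⁺ (x ∷_) (∈-rearrangements⁺ (drop-∷ (↭-trans xv↭w (delete-↭ w x∈))))))
    where xv↭w = ∈-rearrangements⁻ w v∈
          x∈ = ∈-resp-↭ xv↭w (here refl)
  ⊇ : ∀ {v} → v ∈ concatMap f (distinct w) → v ∈ rearrangements w
  ⊇ v∈ with x , x∈ , v∈x ← find (∈-concatMap⁻ f {xs = distinct w} v∈)
       with u , u∈ , refl ← ∈-map⁻ (x ∷_) v∈x =
    ∈-rearrangements⁺ (↭-trans (prep x (∈-rearrangements⁻ (delete x w) u∈)) (↭-sym (delete-↭ w (Distinct.∈-dedup⁻ w x∈))))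

∑-≡ᵇ : ∀ {y} D → Unique D → y ∈ D → ∑ D (λ x → boolℚ (x ≡ᵇ y)) ≡ 1ℚ
∑-≡ᵇ {y} (_ ∷ D) (y∉ ∷ D!) (here refl) rewrite ≡ᵇ-refl y =
  trans (cong (1ℚ +_) (∑-zero D λ x∈ → cong boolℚ (≢⇒≡ᵇ-false (All.lookup y∉ x∈ ∘ sym)))) (ℚ.+-identityʳ 1ℚ)
∑-≡ᵇ {y} (x ∷ D) (x∉ ∷ D!) (there y∈) rewrite ≢⇒≡ᵇ-false (All.lookup x∉ y∈) =
  trans (ℚ.+-identityˡ (∑ D (λ x → boolℚ (x ≡ᵇ y)))) (∑-≡ᵇ D D! y∈)

∑-count : ∀ D w → Unique D → All (_∈ D) w → ∑ D (λ x → ℕ→ℚ (countᵇ x w)) ≡ ℕ→ℚ (length w)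
∑-count D []      D! []        = ∑-zero D (λ _ → refl)
∑-count D (y ∷ w) D! (y∈ ∷ w⊆) = begin
  ∑ D (λ x → ℕ→ℚ (countᵇ x (y ∷ w)))                           ≡⟨ ∑-cong D (λ {x} _ → count-∷ x) ⟩
  ∑ D (λ x → boolℚ (x ≡ᵇ y) + ℕ→ℚ (countᵇ x w))                ≡⟨ ∑-distrib-+ D _ _ ⟩
  ∑ D (λ x → boolℚ (x ≡ᵇ y)) + ∑ D (λ x → ℕ→ℚ (countᵇ x w))    ≡⟨ cong₂ _+_ (∑-≡ᵇ D D! y∈) (∑-count D w D! w⊆) ⟩
  1ℚ + ℕ→ℚ (length w)                                          ≡⟨ sym (ℕ→ℚ-homo-+ 1 (length w)) ⟩
  ℕ→ℚ (suc (length w))                                         ∎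
  where
  open ≡-Reasoning
  count-∷ : ∀ x → ℕ→ℚ (countᵇ x (y ∷ w)) ≡ boolℚ (x ≡ᵇ y) + ℕ→ℚ (countᵇ x w)
  count-∷ x with x ≡ᵇ y
  ... | true  = ℕ→ℚ-homo-+ 1 (countᵇ x w)
  ... | false = sym (ℚ.+-identityˡ (ℕ→ℚ (countᵇ x w)))

-- Orbit–stabiliser: stack 1ℚ v is the product of the factorials of the letter multiplicities of v.
∑-stack : ∀ n w → length w ≡ n → ρ (stack 1ℚ) w ≡ ℕ→ℚ (n !)
∑-stack zero    []  l = refl
∑-stack (suc n) w   l = begin
  ρ (stack 1ℚ) w
    ≡⟨ ∑-↭ (stack 1ℚ) (rearrangements-∷ w n l) ⟩
  ∑ (concatMap (λ x → map (x ∷_) (rearrangements (delete x w))) (distinct w)) (stack 1ℚ)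
    ≡⟨ ∑-concatMap _ (distinct w) (stack 1ℚ) ⟩
  ∑ (distinct w) (λ x → ∑ (map (x ∷_) (rearrangements (delete x w))) (stack 1ℚ))
    ≡⟨ ∑-cong (distinct w) (λ {x} x∈ → first x (Distinct.∈-dedup⁻ w x∈)) ⟩
  ∑ (distinct w) (λ x → ℕ→ℚ (countᵇ x w) * ℕ→ℚ (n !))
    ≡⟨ ∑-*ʳ (distinct w) (λ x → ℕ→ℚ (countᵇ x w)) (ℕ→ℚ (n !)) ⟩
  ∑ (distinct w) (λ x → ℕ→ℚ (countᵇ x w)) * ℕ→ℚ (n !)
    ≡⟨ cong (_* ℕ→ℚ (n !)) (trans (∑-count (distinct w) w (Distinct.dedup-! w) (All.tabulate (Distinct.∈-dedup⁺ w))) (cong ℕ→ℚ l)) ⟩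
  ℕ→ℚ (suc n) * ℕ→ℚ (n !)
    ≡⟨ sym (ℕ→ℚ-homo-* (suc n) (n !)) ⟩
  ℕ→ℚ (suc n !) ∎
  where
  open ≡-Reasoning
  first : ∀ x → x ∈ w → ∑ (map (x ∷_) (rearrangements (delete x w))) (stack 1ℚ) ≡ ℕ→ℚ (countᵇ x w) * ℕ→ℚ (n !)
  first x x∈ = begin
    ∑ (map (x ∷_) (rearrangements (delete x w))) (stack 1ℚ)
      ≡⟨ ∑-map (x ∷_) (rearrangements (delete x w)) (stack 1ℚ) ⟩
    ∑ (rearrangements (delete x w)) (λ v → stack 1ℚ v * factor 1ℚ (countᵇ x v))
      ≡⟨ ∑-cong (rearrangements (delete x w)) (λ {v} v∈ → cong (stack 1ℚ v *_) (multiplicity v (∈-rearrangements⁻ (delete x w) v∈))) ⟩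
    ∑ (rearrangements (delete x w)) (λ v → stack 1ℚ v * ℕ→ℚ (countᵇ x w))
      ≡⟨ ∑-*ʳ (rearrangements (delete x w)) (stack 1ℚ) (ℕ→ℚ (countᵇ x w)) ⟩
    ρ (stack 1ℚ) (delete x w) * ℕ→ℚ (countᵇ x w)
      ≡⟨ cong (_* ℕ→ℚ (countᵇ x w)) (∑-stack n (delete x w) (ℕ.suc-injective (trans (sym (↭-length (delete-↭ w x∈))) l))) ⟩
    ℕ→ℚ (n !) * ℕ→ℚ (countᵇ x w)
      ≡⟨ ℚ.*-comm (ℕ→ℚ (n !)) (ℕ→ℚ (countᵇ x w)) ⟩
    ℕ→ℚ (countᵇ x w) * ℕ→ℚ (n !) ∎
    where
    -- Putting `x` back in front of `v` restores its multiplicity in `w`, so the factor is the same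
    -- for every `v`.
    multiplicity : ∀ v → v ↭ delete x w → factor 1ℚ (countᵇ x v) ≡ ℕ→ℚ (countᵇ x w)
    multiplicity v v↭ = begin
      1ℚ + 1ℚ * ℕ→ℚ (countᵇ x v)  ≡⟨ cong (1ℚ +_) (ℚ.*-identityˡ (ℕ→ℚ (countᵇ x v))) ⟩
      1ℚ + ℕ→ℚ (countᵇ x v)       ≡⟨ sym (ℕ→ℚ-homo-+ 1 (countᵇ x v)) ⟩
      ℕ→ℚ (suc (countᵇ x v))      ≡⟨ cong ℕ→ℚ (sym (count-here x v)) ⟩
      ℕ→ℚ (countᵇ x (x ∷ v))      ≡⟨ cong ℕ→ℚ (↭⇒≋ (↭-trans (prep x v↭) (↭-sym (delete-↭ w x∈))) x) ⟩
      ℕ→ℚ (countᵇ x w)            ∎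

hasDistinct : List ℕ → Bool
hasDistinct w = length (distinct w) ≡ᵇ length w

hasDistinct-∈ : ∀ {x} w → x ∈ w → hasDistinct (x ∷ w) ≡ false
hasDistinct-∈ w x∈ = ≢⇒≡ᵇ-false λ eq →
  ℕ.<-irrefl (trans (sym (#blocks-∈ w x∈)) eq) (s≤s (#blocks≤length w))

hasDistinct-∉ : ∀ {x} w → x ∉ w → hasDistinct (x ∷ w) ≡ hasDistinct w
hasDistinct-∉ w x∉ = cong (_≡ᵇ suc (length w)) (#blocks-∉ w x∉)

hasDistinct-count : ∀ {x} w → hasDistinct w ≡ true → x ∈ w → countᵇ x w ≡ 1
hasDistinct-count {x} (y ∷ w) d x∈ with y ∈? w
... | yes y∈ = contradiction (trans (sym d) (hasDistinct-∈ w y∈)) λ ()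
... | no  y∉ with x∈
...   | here refl = trans (count-here x w) (cong suc (count-∉ w y∉))
...   | there x∈w = trans (count-there w (λ x≡y → y∉ (subst (_∈ w) x≡y x∈w)))
                      (hasDistinct-count w (trans (sym (hasDistinct-∉ w y∉)) d) x∈w)

-- The first repetition met from the right has count exactly 1, so its factor `1 - 1` vanishes and
-- the product stays 0 from there on.
stack-neg : ∀ w → stack (- 1ℚ) w ≡ boolℚ (hasDistinct w)
stack-neg []      = refl
stack-neg (x ∷ w) with x ∈? w
... | no x∉ = begin
  stack (- 1ℚ) w * factor (- 1ℚ) (countᵇ x w) ≡⟨ cong₂ (λ s n → s * factor (- 1ℚ) n) (stack-neg w) (count-∉ w x∉) ⟩
  boolℚ (hasDistinct w) * 1ℚ                  ≡⟨ ℚ.*-identityʳ (boolℚ (hasDistinct w)) ⟩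
  boolℚ (hasDistinct w)                       ≡⟨ cong boolℚ (sym (hasDistinct-∉ w x∉)) ⟩
  boolℚ (hasDistinct (x ∷ w))                 ∎
  where open ≡-Reasoning
... | yes x∈ = trans (cong (_* factor (- 1ℚ) (countᵇ x w)) (stack-neg w)) (trans vanish (cong boolℚ (sym (hasDistinct-∈ w x∈))))
  where
  vanish : boolℚ (hasDistinct w) * factor (- 1ℚ) (countᵇ x w) ≡ 0ℚ
  vanish with hasDistinct w in d
  ... | false = ℚ.*-zeroˡ (factor (- 1ℚ) (countᵇ x w))
  ... | true  = cong (λ n → 1ℚ * factor (- 1ℚ) n) (hasDistinct-count w d x∈)

stack-distinct : ∀ w → hasDistinct w ≡ true → stack 1ℚ w ≡ 1ℚ
stack-distinct []      d = refl
stack-distinct (x ∷ w) d with x ∈? w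
... | yes x∈ = contradiction (trans (sym d) (hasDistinct-∈ w x∈)) λ ()
... | no  x∉ = cong₂ (λ s n → s * factor 1ℚ n) (stack-distinct w (trans (sym (hasDistinct-∉ w x∉)) d)) (count-∉ w x∉)

hasDistinct-↭ : ∀ {u w} → u ↭ w → hasDistinct u ≡ hasDistinct w
hasDistinct-↭ {u} {w} u↭w = cong₂ _≡ᵇ_ (↭-length (unique⇒↭ (Distinct.dedup-! u) (Distinct.dedup-! w)
  (Distinct.∈-dedup⁺ w ∘ ∈-resp-↭ u↭w ∘ Distinct.∈-dedup⁻ u)
  (Distinct.∈-dedup⁺ u ∘ ∈-resp-↭ (↭-sym u↭w) ∘ Distinct.∈-dedup⁻ w))) (↭-length u↭w)

ρ-block-h : ∀ k → ρ (block 1ℚ k) ≈ ℕ→ℚ (k !) • hₖ k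
ρ-block-h k w with length w ℕ.≟ k
... | yes l rewrite T⇒≡true (≡⇒≡ᵇ (length w) k l) =
  trans (∑-cong (rearrangements w) inside) (trans (∑-stack k w l) (sym (ℚ.*-identityʳ (ℕ→ℚ (k !)))))
  where
  inside : ∀ {v} → v ∈ rearrangements w → block 1ℚ k v ≡ stack 1ℚ v
  inside {v} v∈ rewrite T⇒≡true (≡⇒≡ᵇ (length v) k (trans (↭-length (∈-rearrangements⁻ w v∈)) l)) = refl
... | no l≢ rewrite ≢⇒≡ᵇ-false l≢ = trans (ρ-vanish (block 1ℚ k) w outside) (sym (ℚ.*-zeroʳ (ℕ→ℚ (k !))))
  where
  outside : ∀ {v} → v ↭ w → block 1ℚ k v ≡ 0ℚ
  outside v↭w rewrite ↭-length v↭w | ≢⇒≡ᵇ-false l≢ = refl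

-- Whether the letters are distinct depends only on the multiset, so this indicator leaves the sum
-- over rearrangements and the `e` case reduces to the `h` case. Where it is 1, `stack 1ℚ` is 1 as
-- well.
block-neg : ∀ k {v w} → v ↭ w → block (- 1ℚ) k v ≡ boolℚ (hasDistinct w) * block 1ℚ k v
block-neg k {v} {w} v↭w with length v ≡ᵇ k
... | false = sym (ℚ.*-zeroʳ (boolℚ (hasDistinct w)))
... | true  = trans (stack-neg v) (trans absorb (cong (λ b → boolℚ b * stack 1ℚ v) (hasDistinct-↭ v↭w)))
  where
  absorb : boolℚ (hasDistinct v) ≡ boolℚ (hasDistinct v) * stack 1ℚ v
  absorb with hasDistinct v in d
  ... | true  = sym (trans (ℚ.*-identityˡ (stack 1ℚ v)) (stack-distinct v d))
  ... | false = sym (ℚ.*-zeroˡ (stack 1ℚ v))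

ρ-block-e : ∀ k → ρ (block (- 1ℚ) k) ≈ ℕ→ℚ (k !) • eₖ k
ρ-block-e k w = begin
  ρ (block (- 1ℚ) k) w
    ≡⟨ ∑-cong (rearrangements w) (block-neg k ∘ ∈-rearrangements⁻ w) ⟩
  ∑ (rearrangements w) (λ v → d * block 1ℚ k v)
    ≡⟨ ∑-*ˡ d (rearrangements w) (block 1ℚ k) ⟩
  d * ρ (block 1ℚ k) w
    ≡⟨ cong (d *_) (ρ-block-h k w) ⟩
  d * (ℕ→ℚ (k !) * hₖ k w)
    ≡⟨ solve 3 (λ d n h → d :* (n :* h) := n :* (h :* d)) refl d (ℕ→ℚ (k !)) (hₖ k w) ⟩
  ℕ→ℚ (k !) * (hₖ k w * d)
    ≡⟨ cong (ℕ→ℚ (k !) *_) (sym (boolℚ-∧ (length w ≡ᵇ k) (hasDistinct w))) ⟩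
  ℕ→ℚ (k !) * eₖ k w ∎
  where
  open ≡-Reasoning
  d = boolℚ (hasDistinct w)

-- ρ and products

count-replicate : ∀ x c → countᵇ x (replicate c x) ≡ c
count-replicate x zero    = refl
count-replicate x (suc c) = trans (count-here x (replicate c x)) (cong suc (count-replicate x c))

count-replicate-≢ : ∀ {y x} c → y ≢ x → countᵇ y (replicate c x) ≡ 0
count-replicate-≢ zero    y≢x = refl
count-replicate-≢ (suc c) y≢x = trans (count-there (replicate c _) y≢x) (count-replicate-≢ c y≢x)

count-pad : ∀ x c u → countᵇ x u ≡ 0 → countᵇ x (replicate c x ++ u) ≡ c
count-pad x c u u0 = trans (count-++ x (replicate c x) u) (trans (cong₂ ℕ._+_ (count-replicate x c) u0) (ℕ.+-identityʳ c))

count-pad-≢ : ∀ {y x} c u → y ≢ x → countᵇ y (replicate c x ++ u) ≡ countᵇ y u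
count-pad-≢ {y} {x} c u y≢x = trans (count-++ y (replicate c x) u) (cong (ℕ._+ countᵇ y u) (count-replicate-≢ c y≢x))

∈-splits-∷⁻ : ∀ {u v} x xs w → (u , v) ∈ splits (x ∷ xs) w →
  ∃[ c ] ∃₂ λ u′ v′ → c < suc (countᵇ x w) × (u′ , v′) ∈ splits xs w ×
    u ≡ replicate c x ++ u′ × v ≡ replicate (countᵇ x w ∸ c) x ++ v′
∈-splits-∷⁻ x xs w z∈
  with c , c∈ , z∈c ← find (∈-concatMap⁻ _ {xs = upTo (suc (countᵇ x w))} z∈)
  with (u′ , v′) , z′∈ , refl ← ∈-map⁻ _ z∈c = c , u′ , v′ , ∈-upTo⁻ c∈ , z′∈ , refl , refl

splits-∉ : ∀ {u v x} D w → (u , v) ∈ splits D w → x ∉ D → countᵇ x u ≡ 0 × countᵇ x v ≡ 0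
splits-∉ []      w (here refl) x∉ = refl , refl
splits-∉ {x = x} (y ∷ D) w z∈ x∉ with c , u′ , v′ , _ , z′∈ , refl , refl ← ∈-splits-∷⁻ y D w z∈
  with u0 , v0 ← splits-∉ D w z′∈ (x∉ ∘ there) =
  trans (count-pad-≢ c u′ (x∉ ∘ here)) u0 ,
  trans (count-pad-≢ (countᵇ y w ∸ c) v′ (x∉ ∘ here)) v0

splits-∈ : ∀ {u v x} D w → Unique D → (u , v) ∈ splits D w → x ∈ D → countᵇ x u ℕ.+ countᵇ x v ≡ countᵇ x w
splits-∈ {x = x} (y ∷ D) w (y∉ ∷ D!) z∈ x∈
  with c , u′ , v′ , c≤ , z′∈ , refl , refl ← ∈-splits-∷⁻ y D w z∈ | x∈
... | here refl with u0 , v0 ← splits-∉ D w z′∈ (λ y∈ → All.lookup y∉ y∈ refl) =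
  trans (cong₂ ℕ._+_ (count-pad x c u′ u0) (count-pad x (countᵇ x w ∸ c) v′ v0)) (ℕ.m+[n∸m]≡n (ℕ.s≤s⁻¹ c≤))
... | there x∈D = trans (cong₂ ℕ._+_ (count-pad-≢ c u′ x≢y) (count-pad-≢ (countᵇ y w ∸ c) v′ x≢y)) (splits-∈ D w D! z′∈ x∈D)
  where x≢y = λ x≡y → All.lookup y∉ x∈D (sym x≡y)

splits-↭ : ∀ {u v} w → (u , v) ∈ splits (distinct w) w → u ++ v ↭ w
splits-↭ {u} {v} w z∈ = ≋⇒↭ (u ++ v) w λ x → trans (count-++ x u v) (counts x)
  where
  counts : ∀ x → countᵇ x u ℕ.+ countᵇ x v ≡ countᵇ x w
  counts x with x ∈? distinct w
  ... | yes x∈ = splits-∈ (distinct w) w (Distinct.dedup-! w) z∈ x∈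
  ... | no  x∉ with u0 , v0 ← splits-∉ (distinct w) w z∈ x∉ =
    trans (cong₂ ℕ._+_ u0 v0) (sym (count-∉ w (x∉ ∘ Distinct.∈-dedup⁺ w)))

-- The first components must differ as multisets, not just as words, because `factorisations`
-- replaces each by all its rearrangements and the resulting lists have to be disjoint.
splits-! : ∀ D w → Unique D → AllPairs (λ z z′ → ¬ proj₁ z ≋ proj₁ z′) (splits D w)
splits-! []      w D! = [] ∷ []
splits-! (x ∷ D) w (x∉ ∷ D!) = AllPairs.concat⁺
  (All.map⁺ (All.tabulate λ {c} _ → AllPairs.map⁺ (AllPairs.map (λ {z} {z′} → cancel c {z} {z′}) (splits-! D w D!))))
  (AllPairs.map⁺ (AllPairs.map (λ c≢c′ → All.map⁺ (All.tabulate λ z∈ → All.map⁺ (All.tabulate λ z′∈ eq →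
    c≢c′ (trans (sym (count-x z∈)) (trans (eq x) (count-x z′∈)))))) (Unique.upTo⁺ (suc (countᵇ x w)))))
  where
  count-x : ∀ {c u v} → (u , v) ∈ splits D w → countᵇ x (replicate c x ++ u) ≡ c
  count-x {c} {u} z∈ = count-pad x c u (proj₁ (splits-∉ D w z∈ (λ x∈ → All.lookup x∉ x∈ refl)))
  cancel : ∀ c {z z′ : List ℕ × List ℕ} → ¬ proj₁ z ≋ proj₁ z′ → ¬ (replicate c x ++ proj₁ z) ≋ (replicate c x ++ proj₁ z′)
  cancel c {u , _} {u′ , _} u≉u′ eq = u≉u′ λ y → ℕ.+-cancelˡ-≡ (countᵇ y (replicate c x)) _ _
    (trans (sym (count-++ y (replicate c x) u)) (trans (eq y) (count-++ y (replicate c x) u′)))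

-- The recursion over `D` controls the counts of letters in `D` only; for `D = distinct w` every
-- other letter has count 0 throughout.
∈-splits⁺ : ∀ u v w D → Unique D → (∀ x → countᵇ x u ℕ.+ countᵇ x v ≡ countᵇ x w) →
  ∃₂ λ m₁ m₂ → (m₁ , m₂) ∈ splits D w × (∀ x → x ∈ D → countᵇ x u ≡ countᵇ x m₁ × countᵇ x v ≡ countᵇ x m₂)
∈-splits⁺ u v w []      D! eq = [] , [] , here refl , λ _ ()
∈-splits⁺ u v w (x ∷ D) (x∉ ∷ D!) eq with m₁ , m₂ , m∈ , counts ← ∈-splits⁺ u v w D D! eq =
  replicate c x ++ m₁ , replicate (countᵇ x w ∸ c) x ++ m₂ ,
  ∈-concatMap⁺ _ (lose (∈-upTo⁺ (s≤s c≤)) (∈-map⁺ _ m∈)) , counts′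
  where
  c = countᵇ x u
  c≤ : c ≤ countᵇ x w
  c≤ = subst (c ≤_) (eq x) (ℕ.m≤m+n c (countᵇ x v))
  zeros = splits-∉ D w m∈ (λ x∈ → All.lookup x∉ x∈ refl)
  counts′ : ∀ y → y ∈ x ∷ D → countᵇ y u ≡ countᵇ y (replicate c x ++ m₁) × countᵇ y v ≡ countᵇ y (replicate (countᵇ x w ∸ c) x ++ m₂)
  counts′ y (here refl) = sym (count-pad x c m₁ (proj₁ zeros)) ,
    trans (trans (sym (ℕ.m+n∸m≡n c (countᵇ x v))) (cong (_∸ c) (eq x))) (sym (count-pad x (countᵇ x w ∸ c) m₂ (proj₂ zeros)))
  counts′ y (there y∈) = trans (proj₁ (counts y y∈)) (sym (count-pad-≢ c m₁ y≢x)) ,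
                         trans (proj₂ (counts y y∈)) (sym (count-pad-≢ (countᵇ x w ∸ c) m₂ y≢x))
    where y≢x = λ y≡x → All.lookup x∉ y∈ (sym y≡x)

splits-cover : ∀ u v w → u ++ v ↭ w → ∃₂ λ m₁ m₂ → (m₁ , m₂) ∈ splits (distinct w) w × u ↭ m₁ × v ↭ m₂
splits-cover u v w uv↭w = m₁ , m₂ , m∈ , ≋⇒↭ u m₁ (proj₁ ∘ agree) , ≋⇒↭ v m₂ (proj₂ ∘ agree)
  where
  total : ∀ x → countᵇ x u ℕ.+ countᵇ x v ≡ countᵇ x w
  total x = trans (sym (count-++ x u v)) (↭⇒≋ uv↭w x)
  found = ∈-splits⁺ u v w (distinct w) (Distinct.dedup-! w) total
  m₁ = proj₁ found
  m₂ = proj₁ (proj₂ found)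
  m∈ = proj₁ (proj₂ (proj₂ found))
  agree : ∀ x → countᵇ x u ≡ countᵇ x m₁ × countᵇ x v ≡ countᵇ x m₂
  agree x with x ∈? distinct w
  ... | yes x∈ = proj₂ (proj₂ (proj₂ found)) x x∈
  ... | no  x∉ with m₁0 , m₂0 ← splits-∉ (distinct w) w m∈ x∉
               | w0 ← trans (total x) (count-∉ w (x∉ ∘ Distinct.∈-dedup⁺ w)) =
    trans (ℕ.m+n≡0⇒m≡0 (countᵇ x u) w0) (sym m₁0) , trans (ℕ.m+n≡0⇒n≡0 (countᵇ x u) w0) (sym m₂0)

-- Each pair `(u , v)` with `u ++ v` a rearrangement of `w` is listed exactly once. Products in
-- commuting variables thus become sums over pairs of words.
factorisations : List ℕ → List (List ℕ × List ℕ)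
factorisations w = concatMap (λ m → cartesianProduct (rearrangements (proj₁ m)) (rearrangements (proj₂ m))) (splits (distinct w) w)

∈-factorisations⁺ : ∀ {u v} w → u ++ v ↭ w → (u , v) ∈ factorisations w
∈-factorisations⁺ {u} {v} w uv↭w with m₁ , m₂ , m∈ , u↭ , v↭ ← splits-cover u v w uv↭w =
  ∈-concatMap⁺ _ (lose m∈ (∈-cartesianProduct⁺ (∈-rearrangements⁺ u↭) (∈-rearrangements⁺ v↭)))

∈-factorisations⁻ : ∀ {u v} w → (u , v) ∈ factorisations w → u ++ v ↭ w
∈-factorisations⁻ w z∈
  with (m₁ , m₂) , m∈ , z∈m ← find (∈-concatMap⁻ _ {xs = splits (distinct w) w} z∈)
  with u∈ , v∈ ← ∈-cartesianProduct⁻ (rearrangements m₁) (rearrangements m₂) z∈m =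
  ↭-trans (++⁺ (∈-rearrangements⁻ m₁ u∈) (∈-rearrangements⁻ m₂ v∈)) (splits-↭ w m∈)

factorisations-! : ∀ w → Unique (factorisations w)
factorisations-! w = Unique.concat⁺
  (All.map⁺ (All.tabulate λ {m} _ → Unique.cartesianProduct⁺ (rearrangements-! (proj₁ m)) (rearrangements-! (proj₂ m))))
  (AllPairs.map⁺ (AllPairs.map (λ {m} {m′} → disjoint {m} {m′}) (splits-! (distinct w) w (Distinct.dedup-! w))))
  where
  f : List ℕ × List ℕ → List (List ℕ × List ℕ)
  f m = cartesianProduct (rearrangements (proj₁ m)) (rearrangements (proj₂ m))
  disjoint : ∀ {m m′} → ¬ proj₁ m ≋ proj₁ m′ → ∀ {z} → ¬ (z ∈ f m × z ∈ f m′)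
  disjoint {m} {m′} ≉ (z∈ , z∈′) = ≉ λ x → trans
    (sym (↭⇒≋ (∈-rearrangements⁻ (proj₁ m) (proj₁ (∈-cartesianProduct⁻ _ (rearrangements (proj₂ m)) z∈))) x))
    (↭⇒≋ (∈-rearrangements⁻ (proj₁ m′) (proj₁ (∈-cartesianProduct⁻ _ (rearrangements (proj₂ m′)) z∈′))) x)

∑-cartesianProduct : ∀ {A B : Set} (xs : List A) (ys : List B) f g →
  ∑ (cartesianProduct xs ys) (λ z → f (proj₁ z) * g (proj₂ z)) ≡ ∑ xs f * ∑ ys g
∑-cartesianProduct []       ys f g = sym (ℚ.*-zeroˡ (∑ ys g))
∑-cartesianProduct (x ∷ xs) ys f g = begin
  ∑ (map (x ,_) ys ++ cartesianProduct xs ys) (λ z → f (proj₁ z) * g (proj₂ z))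
    ≡⟨ ∑-++ (map (x ,_) ys) (cartesianProduct xs ys) _ ⟩
  ∑ (map (x ,_) ys) (λ z → f (proj₁ z) * g (proj₂ z)) + ∑ (cartesianProduct xs ys) (λ z → f (proj₁ z) * g (proj₂ z))
    ≡⟨ cong₂ _+_ (trans (∑-map (x ,_) ys _) (∑-*ˡ (f x) ys g)) (∑-cartesianProduct xs ys f g) ⟩
  f x * ∑ ys g + ∑ xs f * ∑ ys g
    ≡⟨ sym (ℚ.*-distribʳ-+ (∑ ys g) (f x) (∑ xs f)) ⟩
  (f x + ∑ xs f) * ∑ ys g ∎
  where open ≡-Reasoning

ρ-⊛ : ∀ F G w → (ρ F ⊛ ρ G) w ≡ ∑ (factorisations w) (λ z → F (proj₁ z) * G (proj₂ z))
ρ-⊛ F G w = sym (trans (∑-concatMap _ (splits (distinct w) w) _)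
  (∑-cong (splits (distinct w) w) λ {m} _ → ∑-cartesianProduct (rearrangements (proj₁ m)) (rearrangements (proj₂ m)) F G))

-- inside b π w and outside b π w are the subwords of w at the positions
-- in, respectively not in, the block of π labelled b.
inside outside : ℕ → SetPartition → List ℕ → List ℕ
inside b []      w       = []
inside b (_ ∷ _) []      = []
inside b (c ∷ π) (x ∷ w) = if b ≡ᵇ c then x ∷ inside b π w else inside b π w
outside b []      w       = []
outside b (_ ∷ _) []      = []
outside b (c ∷ π) (x ∷ w) = if b ≡ᵇ c then outside b π w else x ∷ outside b π w

others : ℕ → SetPartition → SetPartition
others b []      = []
others b (c ∷ π) = if b ≡ᵇ c then others b π else c ∷ others b π

inside-length : ∀ b π w → length w ≡ length π → length (inside b π w) ≡ countᵇ b π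
inside-length b []      []      l = refl
inside-length b (c ∷ π) (x ∷ w) l with b ≡ᵇ c
... | true  = cong suc (inside-length b π w (ℕ.suc-injective l))
... | false = inside-length b π w (ℕ.suc-injective l)

others-length : ∀ b π → countᵇ b π ℕ.+ length (others b π) ≡ length π
others-length b []      = refl
others-length b (c ∷ π) with b ≡ᵇ c
... | true  = cong suc (others-length b π)
... | false = trans (ℕ.+-suc (countᵇ b π) (length (others b π))) (cong suc (others-length b π))

inside-outside-↭ : ∀ b π w → length w ≡ length π → inside b π w ++ outside b π w ↭ w
inside-outside-↭ b []      []      l = ↭-refl
inside-outside-↭ b (c ∷ π) (x ∷ w) l with b ≡ᵇ c
... | true  = prep x (inside-outside-↭ b π w (ℕ.suc-injective l))
... | false = ↭-trans (shift x (inside b π w) (outside b π w)) (prep x (inside-outside-↭ b π w (ℕ.suc-injective l)))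

separate : ℕ → SetPartition → List ℕ → List ℕ × List ℕ
separate b π w = inside b π w , outside b π w

separate-injective : ∀ b π u w → length u ≡ length π → length w ≡ length π → separate b π u ≡ separate b π w → u ≡ w
separate-injective b []      []      []      lu lw eq = refl
separate-injective b (c ∷ π) (x ∷ u) (y ∷ w) lu lw eq with b ≡ᵇ c
... | true  with refl , eq′ ← ∷-injective (,-injectiveˡ eq) =
  cong (x ∷_) (separate-injective b π u w (ℕ.suc-injective lu) (ℕ.suc-injective lw) (cong₂ _,_ eq′ (,-injectiveʳ eq)))
... | false with refl , eq′ ← ∷-injective (,-injectiveʳ eq) =
  cong (x ∷_) (separate-injective b π u w (ℕ.suc-injective lu) (ℕ.suc-injective lw) (cong₂ _,_ (,-injectiveˡ eq) eq′))

separate-inside : ∀ b c π x w → (b ≡ᵇ c) ≡ true → separate b (c ∷ π) (x ∷ w) ≡ (x ∷ inside b π w , outside b π w)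
separate-inside b c π x w eq rewrite eq = refl

separate-outside : ∀ b c π x w → (b ≡ᵇ c) ≡ false → separate b (c ∷ π) (x ∷ w) ≡ (inside b π w , x ∷ outside b π w)
separate-outside b c π x w eq rewrite eq = refl

separate-surjective : ∀ b π u v → length u ≡ countᵇ b π → length v ≡ length (others b π) →
                      ∃[ w ] length w ≡ length π × separate b π w ≡ (u , v)
separate-surjective b []      []      []      lu lv = [] , refl , refl
separate-surjective b (c ∷ π) u       v       lu lv with b ≡ᵇ c in eq
separate-surjective b (c ∷ π) (x ∷ u) v       lu lv | true
  with w , l , refl ← separate-surjective b π u v (ℕ.suc-injective lu) lv =
  x ∷ w , cong suc l , separate-inside b c π x w eq
separate-surjective b (c ∷ π) u       (x ∷ v) lu lv | false
  with w , l , refl ← separate-surjective b π u v lu (ℕ.suc-injective lv) =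
  x ∷ w , cong suc l , separate-outside b c π x w eq

unique-map : ∀ {A B : Set} (f : A → B) {xs} → (∀ {x y} → x ∈ xs → y ∈ xs → f x ≡ f y → x ≡ y) →
             Unique xs → Unique (map f xs)
unique-map f inj []           = []
unique-map f inj (x∉ ∷ xs!) =
  All.map⁺ (All.tabulate λ y∈ fx≡fy → All.lookup x∉ y∈ (inj (here refl) (there y∈) fx≡fy)) ∷
  unique-map f (λ x∈ y∈ → inj (there x∈) (there y∈)) xs!

-- Cutting a word along the block `b` is a bijection from the rearrangements of `w` to the
-- factorisations whose first word has the size of the block; `F` vanishes on all other
-- factorisations.
ρ-product : ∀ b π {F G H} →
  (∀ u → length u ≢ countᵇ b π → F u ≡ 0ℚ) →
  (∀ v → length v ≢ length (others b π) → G v ≡ 0ℚ) →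
  (∀ w → length w ≢ length π → H w ≡ 0ℚ) →
  (∀ w → length w ≡ length π → H w ≡ F (inside b π w) * G (outside b π w)) →
  ρ H ≈ ρ F ⊛ ρ G
ρ-product b π {F} {G} {H} F0 G0 H0 H≡ w with length w ℕ.≟ length π
-- Lengths add: two words of the right sizes would give `w` the length of `π`, so one factor always
-- vanishes.
... | no l≢ = trans (ρ-vanish H w (λ v↭w → H0 _ (l≢ ∘ trans (sym (↭-length v↭w)))))
    (sym (trans (ρ-⊛ F G w) (∑-zero (factorisations w) λ {z} → vanish (proj₁ z) (proj₂ z))))
  where
  vanish : ∀ u v → (u , v) ∈ factorisations w → F u * G v ≡ 0ℚ
  vanish u v z∈ with length u ℕ.≟ countᵇ b π
  ... | no lu≢ = trans (cong (_* G v) (F0 u lu≢)) (ℚ.*-zeroˡ (G v))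
  ... | yes lu = trans (cong (F u *_) (G0 v λ lv → l≢ (begin
      length w                                   ≡⟨ ↭-length (∈-factorisations⁻ w z∈) ⟨
      length (u ++ v)                            ≡⟨ length-++ u ⟩
      length u ℕ.+ length v                      ≡⟨ cong₂ ℕ._+_ lu lv ⟩
      countᵇ b π ℕ.+ length (others b π)         ≡⟨ others-length b π ⟩
      length π                                   ∎))) (ℚ.*-zeroʳ (F u))
    where open ≡-Reasoning
... | yes l≡ = begin
  ρ H w                                            ≡⟨ ∑-cong (rearrangements w) (λ v∈ → H≡ _ (len v∈)) ⟩
  ∑ (rearrangements w) (FG ∘ separate b π)         ≡⟨ ∑-map (separate b π) (rearrangements w) FG ⟨
  ∑ (map (separate b π) (rearrangements w)) FG     ≡⟨ ∑-↭ FG bijection ⟩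
  ∑ (filter right-size? (factorisations w)) FG     ≡⟨ ∑-filter right-size? (factorisations w) FG
                                                        (λ {z} _ lu≢ → trans (cong (_* G (proj₂ z)) (F0 (proj₁ z) lu≢)) (ℚ.*-zeroˡ (G (proj₂ z)))) ⟩
  ∑ (factorisations w) FG                          ≡⟨ ρ-⊛ F G w ⟨
  (ρ F ⊛ ρ G) w                                    ∎
  where
  open ≡-Reasoning
  FG : List ℕ × List ℕ → ℚ
  FG z = F (proj₁ z) * G (proj₂ z)
  right-size? : Decidable (λ (z : List ℕ × List ℕ) → length (proj₁ z) ≡ countᵇ b π)
  right-size? z = length (proj₁ z) ℕ.≟ countᵇ b π
  len : ∀ {v} → v ∈ rearrangements w → length v ≡ length π
  len v∈ = trans (↭-length (∈-rearrangements⁻ w v∈)) l≡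
  ⊆ : ∀ {z} → z ∈ map (separate b π) (rearrangements w) → z ∈ filter right-size? (factorisations w)
  ⊆ z∈ with v , v∈ , refl ← ∈-map⁻ (separate b π) z∈ = ∈-filter⁺ right-size?
    (∈-factorisations⁺ w (↭-trans (inside-outside-↭ b π v (len v∈)) (∈-rearrangements⁻ w v∈)))
    (inside-length b π v (len v∈))
  ⊇ : ∀ {z} → z ∈ filter right-size? (factorisations w) → z ∈ map (separate b π) (rearrangements w)
  ⊇ {u , v} z∈ with z∈w , lu ← ∈-filter⁻ right-size? {xs = factorisations w} z∈
    -- The filter fixes only the length of `u`; that of `v` follows, and both are needed to
    -- reassemble a word along `π`.
    with lv ← ℕ.+-cancelˡ-≡ (countᵇ b π) (length v) (length (others b π)) (begin
      countᵇ b π ℕ.+ length v   ≡⟨ cong (ℕ._+ length v) lu ⟨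
      length u ℕ.+ length v     ≡⟨ length-++ u ⟨
      length (u ++ v)           ≡⟨ ↭-length (∈-factorisations⁻ w z∈w) ⟩
      length w                  ≡⟨ l≡ ⟩
      length π                  ≡⟨ others-length b π ⟨
      countᵇ b π ℕ.+ length (others b π) ∎)
    with v′ , l′ , refl ← separate-surjective b π u v lu lv =
    ∈-map⁺ (separate b π) (∈-rearrangements⁺ (↭-trans (↭-sym (inside-outside-↭ b π v′ l′)) (∈-factorisations⁻ w z∈w)))
  bijection : map (separate b π) (rearrangements w) ↭ filter right-size? (factorisations w)
  bijection = unique⇒↭
    (unique-map (separate b π) (λ u∈ v∈ → separate-injective b π _ _ (len u∈) (len v∈)) (rearrangements-! w))
    (Unique.filter⁺ right-size? (factorisations-! w)) ⊆ ⊇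

countPair-inside : ∀ b x π w → countPair (b , x) (zip π w) ≡ countᵇ x (inside b π w)
countPair-inside b x []      w       = refl
countPair-inside b x (_ ∷ _) []      = refl
countPair-inside b x (c ∷ π) (y ∷ w) with b ≡ᵇ c
... | false = countPair-inside b x π w
... | true with x ≡ᵇ y
...   | true  = cong suc (countPair-inside b x π w)
...   | false = countPair-inside b x π w

countPair-outside : ∀ {b c} x π w → b ≢ c → countPair (c , x) (zip π w) ≡ countPair (c , x) (zip (others b π) (outside b π w))
countPair-outside x []      w       b≢c = refl
countPair-outside {b} {c} x (d ∷ π) [] b≢c with others b (d ∷ π)
... | []    = refl
... | _ ∷ _ = refl
countPair-outside {b} {c} x (d ∷ π) (y ∷ w) b≢c with b ≡ᵇ d | ≡ᵇ-reflects b d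
... | true  | ofʸ refl rewrite ≢⇒≡ᵇ-false (b≢c ∘ sym) = countPair-outside x π w b≢c
... | false | _ with eqPair (c , x) (d , y)
...   | true  = cong suc (countPair-outside x π w b≢c)
...   | false = countPair-outside x π w b≢c

-- The factor at a position looks only at later positions with the same label, so the factors inside
-- the block `b` and those outside it do not interact.
E-separate : ∀ ε b π w → length w ≡ length π → E ε π w ≡ stack ε (inside b π w) * E ε (others b π) (outside b π w)
E-separate ε b []      []      l = refl
E-separate ε b (c ∷ π) (x ∷ w) l with b ≡ᵇ c | ≡ᵇ-reflects b c | E-separate ε b π w (ℕ.suc-injective l)
... | true | ofʸ refl | ih = begin
  E ε π w * factor ε (countPair (b , x) (zip π w))  ≡⟨ cong₂ (λ s n → s * factor ε n) ih (countPair-inside b x π w) ⟩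
  S * R * f                                         ≡⟨ solve 3 (λ s r f → s :* r :* f := s :* f :* r) refl S R f ⟩
  S * f * R                                         ∎
  where
  open ≡-Reasoning
  S = stack ε (inside b π w)
  R = E ε (others b π) (outside b π w)
  f = factor ε (countᵇ x (inside b π w))
... | false | ofⁿ b≢c | ih = trans (cong₂ (λ s n → s * factor ε n) ih (countPair-outside x π w b≢c)) (ℚ.*-assoc S R f)
  where
  S = stack ε (inside b π w)
  R = E ε (others b π) (outside b π w)
  f = factor ε (countPair (c , x) (zip (others b π) (outside b π w)))

ρ-E-product : ∀ ε b π → ρ (E ε π) ≈ ρ (block ε (countᵇ b π)) ⊛ ρ (E ε (others b π))
ρ-E-product ε b π = ρ-product b π block0 (E-length ε (others b π)) (E-length ε π)
  (λ w l → trans (E-separate ε b π w l) (cong (_* E ε (others b π) (outside b π w)) (sym (on-size w l))))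
  where
  block0 : ∀ u → length u ≢ countᵇ b π → block ε (countᵇ b π) u ≡ 0ℚ
  block0 u ≢ rewrite ≢⇒≡ᵇ-false ≢ = refl
  on-size : ∀ w → length w ≡ length π → block ε (countᵇ b π) (inside b π w) ≡ stack ε (inside b π w)
  on-size w l rewrite T⇒≡true (≡⇒≡ᵇ _ _ (inside-length b π w l)) = refl

⊛-cong : ∀ {F F′ G G′} → F ≈ F′ → G ≈ G′ → F ⊛ G ≈ F′ ⊛ G′
⊛-cong F≈ G≈ w = ∑-cong (splits (distinct w) w) λ {m} _ → cong₂ _*_ (F≈ (proj₁ m)) (G≈ (proj₂ m))

⊛-• : ∀ a b F G → (a • F) ⊛ (b • G) ≈ (a * b) • (F ⊛ G)
⊛-• a b F G w = trans
  (∑-cong (splits (distinct w) w) λ {m} _ →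
    solve 4 (λ a b f g → (a :* f) :* (b :* g) := (a :* b) :* (f :* g)) refl a b (F (proj₁ m)) (G (proj₂ m)))
  (∑-*ˡ (a * b) (splits (distinct w) w) _)

-- The type of a set partition

productΛ : (ℕ → Series) → List ℕ → Series
productΛ g = foldr (λ k acc → g k ⊛ acc) oneΛ

-- λs is the type of π and scalar is λs! in the notation ρ(e_π) = λ! e_λ.
record Shape (bound : ℕ) (π : SetPartition) : Set where
  field
    λs        : List ℕ
    isPartition : IsPartition λs
    bounded   : All (_≤ bound) λs
    scalar    : ℚ
    inverse   : ℚ
    inverse-* : inverse * scalar ≡ 1ℚ
    ρ-E       : ∀ ε g → (∀ k → ρ (block ε k) ≈ ℕ→ℚ (k !) • g k) → ρ (E ε π) ≈ scalar • productΛ g λs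

ρ-E-[] : ∀ ε → ρ (E ε []) ≈ 1ℚ • oneΛ
ρ-E-[] ε []      = refl
ρ-E-[] ε (x ∷ w) = ρ-vanish (E ε []) (x ∷ w) λ {v} v↭w → E-length ε [] v λ l → ℕ.1+n≢0 (trans (sym (↭-length v↭w)) l)

others-count : ∀ b c π → countᵇ c (others b π) ≤ countᵇ c π
others-count b c []      = z≤n
others-count b c (d ∷ π) with b ≡ᵇ d
... | true  with c ≡ᵇ d
...   | true  = ℕ.m≤n⇒m≤1+n (others-count b c π)
...   | false = others-count b c π
others-count b c (d ∷ π) | false with c ≡ᵇ d
...   | true  = s≤s (others-count b c π)
...   | false = others-count b c π

count-bound : ∀ {m} d π → (d ∈ π → countᵇ d π ≤ m) → countᵇ d π ≤ m
count-bound d π bound with d ∈? π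
... | yes d∈ = bound d∈
... | no  d∉ = subst (_≤ _) (sym (count-∉ π d∉)) z≤n

largest-block : ∀ c π → ∃[ b ] b ∈ c ∷ π × (∀ d → countᵇ d (c ∷ π) ≤ countᵇ b (c ∷ π))
largest-block c π = b , b∈ , largest
  where
  size : ℕ → ℕ
  size d = countᵇ d (c ∷ π)
  b = argmax size c (c ∷ π)
  b∈ : b ∈ c ∷ π
  b∈ = [ here , id ]′ (argmax-sel size c (c ∷ π))
  sizes : All (λ d → size d ≤ size b) (c ∷ π)
  sizes = f[xs]≤f[argmax] {f = size} c (c ∷ π)
  largest : ∀ d → size d ≤ size b
  -- `sizes` covers the labels that occur; all others have count 0.
  largest d = count-bound {size b} d (c ∷ π) (λ d∈ → All.lookup sizes d∈)

linked-∷ : ∀ {k ls} → All (_≤ k) ls → Linked ℕ._≥_ ls → Linked ℕ._≥_ (k ∷ ls)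
linked-∷ []         ls↘ = [-]
linked-∷ (l≤k ∷ _)  ls↘ = l≤k ∷ ls↘

inverses-* : ∀ a⁻¹ a b⁻¹ b → a⁻¹ * a ≡ 1ℚ → b⁻¹ * b ≡ 1ℚ → (a⁻¹ * b⁻¹) * (a * b) ≡ 1ℚ
inverses-* a⁻¹ a b⁻¹ b a-inv b-inv = trans
  (solve 4 (λ a⁻¹ a b⁻¹ b → (a⁻¹ :* b⁻¹) :* (a :* b) := (a⁻¹ :* a) :* (b⁻¹ :* b)) refl a⁻¹ a b⁻¹ b)
  (trans (cong₂ _*_ a-inv b-inv) (ℚ.*-identityˡ 1ℚ))

-- Kept general in `ε` and `g`, so that `e` with `eₖ` and `h` with `hₖ` acquire the same scalar and
-- the same parts.
ρ-E-step : ∀ ε g b π {c μ} → (∀ k → ρ (block ε k) ≈ ℕ→ℚ (k !) • g k) →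
           ρ (E ε (others b π)) ≈ c • productΛ g μ →
           ρ (E ε π) ≈ (ℕ→ℚ (countᵇ b π !) * c) • productΛ g (countᵇ b π ∷ μ)
ρ-E-step ε g b π {c} {μ} ρ-block ρ-rest w = begin
  ρ (E ε π) w
    ≡⟨ ρ-E-product ε b π w ⟩
  (ρ (block ε k) ⊛ ρ (E ε (others b π))) w
    ≡⟨ ⊛-cong {ρ (block ε k)} {ℕ→ℚ (k !) • g k} {ρ (E ε (others b π))} {c • productΛ g μ} (ρ-block k) ρ-rest w ⟩
  ((ℕ→ℚ (k !) • g k) ⊛ (c • productΛ g μ)) w
    ≡⟨ ⊛-• (ℕ→ℚ (k !)) c (g k) (productΛ g μ) w ⟩
  ((ℕ→ℚ (k !) * c) • (g k ⊛ productΛ g μ)) w ∎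
  where
  open ≡-Reasoning
  k = countᵇ b π

-- Since the removed block is a largest one, all parts of the remainder are at most `k`, which is
-- what a weakly decreasing list needs.
shape-∷ : ∀ {bound} π → (∃[ b ] b ∈ π × (∀ d → countᵇ d π ≤ countᵇ b π)) → (∀ d → countᵇ d π ≤ bound) →
          (∀ b → b ∈ π → (∀ d → countᵇ d π ≤ countᵇ b π) → Shape (countᵇ b π) (others b π)) → Shape bound π
shape-∷ π (b , b∈ , largest) ≤bound rest = record
  { λs          = k ∷ λs
  ; isPartition = k>0 ∷ proj₁ isPartition , linked-∷ bounded (proj₂ isPartition)
  ; bounded     = ≤bound b ∷ All.map (λ l → ≤-trans l (≤bound b)) bounded
  ; scalar      = ℕ→ℚ (k !) * scalar
  ; inverse     = proj₁ k!⁻¹ * inverse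
  ; inverse-*   = inverses-* (proj₁ k!⁻¹) (ℕ→ℚ (k !)) inverse scalar (proj₂ k!⁻¹) inverse-*
  ; ρ-E         = λ ε g ρ-block → ρ-E-step ε g b π {scalar} {λs} ρ-block (ρ-E ε g ρ-block)
  }
  where
  k = countᵇ b π
  k>0 : 0 < k
  k>0 = ∈⇒0<count π b∈
  k!⁻¹ = ℕ→ℚ-inverse (k !) (ℕ.1≤n! k)
  open Shape (rest b b∈ largest)

others-shorter : ∀ {b} π → b ∈ π → length (others b π) < length π
others-shorter {b} π b∈ = subst (suc (length (others b π)) ≤_) (others-length b π)
  (ℕ.+-monoˡ-≤ (length (others b π)) (∈⇒0<count π b∈))

-- The parts come out in decreasing order because a largest block is split off first.
shape : ∀ fuel bound π → length π ≤ fuel → (∀ d → countᵇ d π ≤ bound) → Shape bound π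
shape fuel bound [] _ _ = record
  { λs = [] ; isPartition = [] , [] ; bounded = [] ; scalar = 1ℚ ; inverse = 1ℚ ; inverse-* = refl
  ; ρ-E = λ ε g _ → ρ-E-[] ε }
shape (suc fuel) bound (c ∷ π) l≤ ≤bound = shape-∷ (c ∷ π) (largest-block c π) ≤bound λ b b∈ largest →
  shape fuel (countᵇ b (c ∷ π)) (others b (c ∷ π)) (ℕ.s≤s⁻¹ (≤-trans (others-shorter (c ∷ π) b∈) l≤))
    (λ d → ≤-trans (others-count b d (c ∷ π)) (largest d))

count≤length : ∀ d π → countᵇ d π ≤ length π
count≤length d []      = z≤n
count≤length d (c ∷ π) with d ≡ᵇ c
... | true  = s≤s (count≤length d π)
... | false = ℕ.m≤n⇒m≤1+n (count≤length d π)

-- The involution of Λ and its compatibility with `ρ`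

InΛ-≈ : ∀ {F G} → F ≈ G → InΛ F → InΛ G
InΛ-≈ F≈G (F-comm , F∈) = (λ u w u↭w → trans (sym (F≈G u)) (trans (F-comm u w u↭w) (F≈G w))) , InΠ-≈ F≈G F∈

InΛ-• : ∀ {F} a → InΛ F → InΛ (a • F)
InΛ-• a (F-comm , F∈) = (λ u w u↭w → cong (a *_) (F-comm u w u↭w)) , InΠ-• a F∈

module OmegaΛ {ωΛ : Series → Series} (ωΛ-linear : IsLinearOn InΛ ωΛ)
              (ωΛ-e : ∀ λs → IsPartition λs → ωΛ (eΛ λs) ≈ hΛ λs) where

  private
    congruent = proj₁ (proj₂ ωΛ-linear)
    additive  = proj₁ (proj₂ (proj₂ ωΛ-linear))
    homogen   = proj₂ (proj₂ (proj₂ ωΛ-linear))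

  -- A single `Shape` describes `ρ (e π)` and `ρ (h π)` by the same scalar and parts, and the scalar
  -- passes through `ωΛ`.
  ωΛ-ρe : ∀ π → ωΛ (ρ (e π)) ≈ ρ (h π)
  ωΛ-ρe π w = begin
    ωΛ (ρ (e π)) w          ≡⟨ congruent (ρ (e π)) (scalar • eΛ λs) (InΛ-ρ (InΠ-e π)) (InΛ-• scalar InΛ-e) ρe≈ w ⟩
    ωΛ (scalar • eΛ λs) w   ≡⟨ homogen scalar (eΛ λs) InΛ-e w ⟩
    scalar * ωΛ (eΛ λs) w   ≡⟨ cong (scalar *_) (ωΛ-e λs isPartition w) ⟩
    scalar * hΛ λs w        ≡⟨ ρ-E 1ℚ hₖ ρ-block-h w ⟨
    ρ (E 1ℚ π) w            ≡⟨ ρ-cong (h≈E π) w ⟨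
    ρ (h π) w               ∎
    where
    open ≡-Reasoning
    open Shape (shape (length π) (length π) π ≤-refl (λ d → count≤length d π))
    ρe≈ : ρ (e π) ≈ scalar • eΛ λs
    ρe≈ v = trans (ρ-cong (e≈E π) v) (ρ-E (- 1ℚ) eₖ ρ-block-e v)
    -- As a nonzero scalar multiple of `ρ (e π)`, the product `eΛ λs` inherits membership in Λ from
    -- it; closure of Λ under `⊛` is not invoked.
    InΛ-e : InΛ (eΛ λs)
    InΛ-e = InΛ-≈
      (λ v → trans (cong (inverse *_) (ρe≈ v)) (trans (sym (ℚ.*-assoc inverse scalar (eΛ λs v)))
               (trans (cong (_* eΛ λs v) inverse-*) (ℚ.*-identityˡ (eΛ λs v)))))
      (InΛ-• inverse (InΛ-ρ (InΠ-e π)))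

  ωΛ-Lin : ∀ {F G} → Lin e h F G → ωΛ (ρ F) ≈ ρ G
  ωΛ-Lin (gen π) = ωΛ-ρe π
  ωΛ-Lin zero w  = begin
    ωΛ (ρ 0#) w          ≡⟨ congruent (ρ 0#) (0ℚ • ρ 0#) (InΛ-ρ InΠ-0) (InΛ-• 0ℚ (InΛ-ρ InΠ-0))
                              (λ v → trans (ρ-0 v) (sym (ℚ.*-zeroˡ (ρ 0# v)))) w ⟩
    ωΛ (0ℚ • ρ 0#) w     ≡⟨ homogen 0ℚ (ρ 0#) (InΛ-ρ InΠ-0) w ⟩
    0ℚ * ωΛ (ρ 0#) w     ≡⟨ ℚ.*-zeroˡ (ωΛ (ρ 0#) w) ⟩
    0ℚ                   ≡⟨ ρ-0 w ⟨
    ρ 0# w               ∎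
    where open ≡-Reasoning
  ωΛ-Lin (_⊞_ {F} {F′} {G} {G′} l l′) w = begin
    ωΛ (ρ (F ⊕ F′)) w          ≡⟨ congruent (ρ (F ⊕ F′)) (ρ F ⊕ ρ F′) F⊕F′∈ (InΛ-≈ (ρ-⊕ F F′) F⊕F′∈) (ρ-⊕ F F′) w ⟩
    ωΛ (ρ F ⊕ ρ F′) w          ≡⟨ additive (ρ F) (ρ F′) (InΛ-ρ (InΠ-Lin l)) (InΛ-ρ (InΠ-Lin l′)) w ⟩
    ωΛ (ρ F) w + ωΛ (ρ F′) w   ≡⟨ cong₂ _+_ (ωΛ-Lin l w) (ωΛ-Lin l′ w) ⟩
    ρ G w + ρ G′ w             ≡⟨ ρ-⊕ G G′ w ⟨
    ρ (G ⊕ G′) w               ∎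
    where
    open ≡-Reasoning
    F⊕F′∈ = InΛ-ρ (InΠ-⊕ (InΠ-Lin l) (InΠ-Lin l′))
  ωΛ-Lin (scale {F} {G} a l) w = begin
    ωΛ (ρ (a • F)) w   ≡⟨ congruent (ρ (a • F)) (a • ρ F) (InΛ-ρ (InΠ-• a (InΠ-Lin l))) (InΛ-• a F∈) (ρ-• a F) w ⟩
    ωΛ (a • ρ F) w     ≡⟨ homogen a (ρ F) F∈ w ⟩
    a * ωΛ (ρ F) w     ≡⟨ cong (a *_) (ωΛ-Lin l w) ⟩
    a * ρ G w          ≡⟨ ρ-• a G w ⟨
    ρ (a • G) w        ∎
    where
    open ≡-Reasoning
    F∈ = InΛ-ρ (InΠ-Lin l)
  ωΛ-Lin (respects {F} {F′} F≈F′ G≈G′ l) w = trans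
    (congruent (ρ F′) (ρ F) (InΛ-ρ (InΠ-≈ F≈F′ (InΠ-Lin l))) (InΛ-ρ (InΠ-Lin l)) (ρ-cong (sym ∘ F≈F′)) w)
    (trans (ωΛ-Lin l w) (ρ-cong G≈G′ w))

theorem3p5 : (ω : Series → Series) → IsLinearOn InΠ ω
    → (∀ π → ω (e π) ≈ h π)
    → (ωΛ : Series → Series) → IsLinearOn InΛ ωΛ
    → (∀ λs → IsPartition λs → ωΛ (eΛ λs) ≈ hΛ λs)
    → (∀ F → InΠ F → ω (ω F) ≈ F)
    × (∀ π → ω (p π) ≈ sgn π • p π)
    × (∀ F → InΠ F → ρ (ω F) ≈ ωΛ (ρ F))
theorem3p5 ω ω-linear ω-e ωΛ ωΛ-linear ωΛ-e = ω-involutive , ω-p , commutes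
  where
  open Omega ω-linear ω-e
  open OmegaΛ ωΛ-linear ωΛ-e
  -- Both sides are `ρ` of the image attached to `F` by its expansion in the `e`.
  commutes : ∀ F → InΠ F → ρ (ω F) ≈ ωΛ (ρ F)
  commutes F F∈ w = trans (ρ-cong (ω-Lin to) w) (sym (ωΛ-Lin to w))
    where open Expansion (decompose F F∈)
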